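{- Let $H_1$ and $H_2$ be graphs, neither of which is isomorphic to $\overline{P_1+P_3}$ or $P_1+P_3$, with $\{H_1,H_2\}\ne\{3P_1,\overline{S_{1,2,3}}\}$, and let $\mathcal{G}$ be the class of $(H_1,H_2)$-free graphs. Then $\mathcal{G}$ satisfies none of the four conditions (A), (B), (C), (D) below if and only if the unordered pair $\{H_1,H_2\}$ is one of the 18 pairs listed in (E). (A) $\mathcal{G}$ is equivalent to a class of $(F_1,F_2)$-free graphs such that one of the following holds: - $F_1\subseteq_i P_4$ or $F_2\subseteq_i P_4$; - $F_1=K_s$ and $F_2=tP_1$ for some $s,t\ge1$; - $F_1\subseteq_i\mathrm{paw}$ and $F_2\subseteq_i K_{1,3}+3P_1$, $K_{1,3}+P_2$, $P_1+P_2+P_3$, $P_1+P_5$, $P_1+S_{1,1,2}$, $P_2+P_4$, $P_6$, $S_{1,1,3}$ or $S_{1,2,2}$; - $F_1\subseteq_i\mathrm{diamond}$ and $F_2\subseteq_i P_1+2P_2$, $3P_1+P_2$ or $P_2+P_3$; - $F_1\subseteq_i\mathrm{gem}$ and $F_2\subseteq_i P_1+P_4$ or $P_5$; - $F_1\subseteq_i K_3+P_1$ and $F_2\subseteq_i K_{1,3}$; - $F_1\subseteq_i\overline{2P_1+P_3}$ and $F_2\subseteq_i 2P_1+P_3$. (B) $\mathcal{G}$ is a subclass of the class of $(P_6,\overline{2P_2})$-free graphs or of the class of $(2P_2,\overline{P_2+P_3})$-free graphs. (C) $\mathcal{G}$ is equivalent to a class of $(F_1,F_2)$-free graphs such that one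 of the following holds: - $F_1\notin\mathcal{S}$ and $F_2\notin\mathcal{S}$; - $F_1\notin\overline{\mathcal{S}}$ and $F_2\notin\overline{\mathcal{S}}$; - $F_1\supseteq_i K_3+P_1$ and $F_2\supseteq_i 4P_1$ or $2P_2$; - $F_1\supseteq_i\mathrm{diamond}$ and $F_2\supseteq_i K_{1,3}$, $5P_1$ or $P_2+P_4$; - $F_1\supseteq_i K_3$ and $F_2\supseteq_i 2P_1+2P_2$, $2P_1+P_4$, $4P_1+P_2$, $3P_2$ or $2P_3$; - $F_1\supseteq_i K_4$ and $F_2\supseteq_i P_1+P_4$, $3P_1+P_2$ or $2P_2$; - $F_1\supseteq_i\mathrm{gem}$ and $F_2\supseteq_i P_1+2P_2$. (D) $\mathcal{G}$ contains the class of $(F_1,F_2)$-free graphs for some $F_1,F_2$ such that one of the following holds: - $F_1\supseteq_i\mathrm{diamond}$ and $F_2\supseteq_i P_1+P_6$; - $F_1\supseteq_i 2P_1+P_2$ and $F_2\supseteq_i\overline{P_6}$; - $F_1\supseteq_i\mathrm{gem}$ and $F_2\supseteq_i P_6$; - $F_1\supseteq_i P_1+2P_2$ or $P_6$, and $F_2\supseteq_i\overline{P_1+2P_2}$ or $\overline{P_2+P_3}$; - $F_1\supseteq_i 2P_2$ and $F_2\supseteq_i\overline{P_2+P_4}$, $\overline{3P_2}$ or $\overline{P_5}$. (E) The pairs $\{A,B\}$ with: - $A=\mathrm{diamond}$ and $B=P_6$; - $A=C_4$ and $B\in\{P_1+2P_2,\ P_2+P_4,\ 3P_2\}$; - $A=\overline{P_1+2P_2}$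 and $B\in\{2P_2,\ P_2+P_3,\ P_5\}$; - $A=\overline{P_2+P_3}$ and $B\in\{P_2+P_3,\ P_5\}$; - $A=K_3$ and $B\in\{P_1+S_{1,1,3},\ S_{1,2,3}\}$; - $A=3P_1$ and $B=\overline{P_1+S_{1,1,3}}$; - $A=\mathrm{diamond}$ and $B\in\{P_1+P_2+P_3,\ P_1+P_5\}$; - $A=2P_1+P_2$ and $B\in\{\overline{P_1+P_2+P_3},\ \overline{P_1+P_5}\}$; - $A=\mathrm{gem}$ and $B=P_2+P_3$; - $A=P_1+P_4$ and $B=\overline{P_2+P_3}$. (In a list such as "$F\subseteq_i X$, $Y$ or $Z$" the relation is meant to hold for at least one of the listed graphs, and similarly for $\supseteq_i$.)
   Context: Graphs are finite, simple and undirected, and considered up to isomorphism. $F\subseteq_i G$ (equivalently $G\supseteq_i F$) means that $F$ is (isomorphic to) an induced subgraph of $G$. A graph is $(H_1,H_2)$-free if it contains neither $H_1$ nor $H_2$ as an induced subgraph. $C_t,K_t,P_t$ are the cycle, complete graph and path on $t$ vertices; $K_{s,t}$ is the complete bipartite graph; $G_1+G_2$ is the disjoint union; $rG$ is the disjoint union of $r$ copies of $G$; $\overline{G}$ is the complement. The paw is $\overline{P_1+P_3}$, the diamond is $\overline{2P_1+P_2}$, the gem is $\overline{P_1+P_4}$. For $1\le h\le i\le j$, the subdivided claw $S_{h,i,j}$ is the tree with one vertex $x$ of degree $3$ and exactly three leaves, at distances $h,i,j$ from $x$. $\mathcal{S}$ is the class of graphs every connected component of which is a subdivided claw or a path on at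 least one vertex; $\overline{\mathcal{S}}$ is the class of complements of graphs in $\mathcal{S}$. The classes of $(H_1,H_2)$-free graphs and $(H_3,H_4)$-free graphs are equivalent if the unordered pair $H_3,H_4$ can be obtained from the unordered pair $H_1,H_2$ by some combination of the operations: (1) complementing both graphs in the pair; (2) if one of the graphs in the pair is $3P_1$, replacing it with $P_1+P_3$, or vice versa. Conditions (A) and (B) are the sufficient conditions known for the class of atoms (graphs with no clique cut-set) in $\mathcal{G}$ to have bounded clique-width, and (C) and (D) are the sufficient conditions known for it to have unbounded clique-width; the theorem says that the pairs left undecided by these conditions are exactly those in (E). -}

module Defs where

open import Data.Bool using (Bool; true; false; not; _∧_; _∨_)
open import Data.Bool.Properties using (∨-comm)
open import Data.Fin using (Fin; toℕ; splitAt; _≟_)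
open import Data.List using (List; []; _∷_)
open import Data.List.Relation.Unary.Any using (Any)
open import Data.Nat using (ℕ; zero; suc; _+_; _≤_; _≡ᵇ_; _<ᵇ_; _≤ᵇ_; pred; NonZero)
open import Data.Nat.DivMod using (_%_)
open import Data.Product using (Σ; ∃; ∃-syntax; _×_; _,_)
open import Data.Sum using (_⊎_; inj₁; inj₂)
open import Function.Bundles using (_↣_; _↔_; _⇔_; mk⇔; Injection; Inverse)
open import Level using (0ℓ)
open import Relation.Binary.Construct.Closure.ReflexiveTransitive using (Star)
open import Relation.Binary.Core using (Rel)
open import Relation.Binary.PropositionalEquality using (_≡_; refl; sym; cong; cong₂)
open import Relation.Nullary using (¬_; does)
open import Relation.Nullary.Decidable using (does-⇔; dec-true)
open import Relation.Unary using (Pred; _∈_; _∉_; _⊆_)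

record Graph : Set where
  field
    order   : ℕ
    adj     : Fin order → Fin order → Bool
    adj-sym : ∀ i j → adj i j ≡ adj j i
    adj-irr : ∀ i → adj i i ≡ false

  Vertex : Set
  Vertex = Fin order

  Adjacent : Rel Vertex 0ℓ
  Adjacent i j = adj i j ≡ true

open Graph public

infix 4 _≅_ _⊆ᵢ_ _⊇ᵢ_

_≅_ : Graph → Graph → Set
G ≅ H = Σ (Vertex G ↔ Vertex H) λ f →
  ∀ i j → adj G i j ≡ adj H (Inverse.to f i) (Inverse.to f j)

_⊆ᵢ_ : Graph → Graph → Set
F ⊆ᵢ G = Σ (Vertex F ↣ Vertex G) λ f →
  ∀ i j → adj F i j ≡ adj G (Injection.to f i) (Injection.to f j)

_⊇ᵢ_ : Graph → Graph → Set
G ⊇ᵢ F = F ⊆ᵢ G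

-- Lists such as "F ⊆ᵢ X, Y or Z".
_⊆ᵢ-some_ : Graph → List Graph → Set
F ⊆ᵢ-some Xs = Any (F ⊆ᵢ_) Xs

_⊇ᵢ-some_ : Graph → List Graph → Set
F ⊇ᵢ-some Xs = Any (F ⊇ᵢ_) Xs

infix 4 _⊆ᵢ-some_ _⊇ᵢ-some_

distinct : ∀ {n} → Fin n → Fin n → Bool
distinct i j = not (does (i ≟ j))

distinct-sym : ∀ {n} (i j : Fin n) → distinct i j ≡ distinct j i
distinct-sym i j = cong not (does-⇔ (mk⇔ sym sym) (i ≟ j) (j ≟ i))

distinct-irr : ∀ {n} (i : Fin n) → distinct i i ≡ false
distinct-irr i = cong not (dec-true (i ≟ i) refl)

-- The simple graph on 0, …, n - 1 in which distinct i and j are adjacent iff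
-- r i j or r j i.
graph : (n : ℕ) → (ℕ → ℕ → Bool) → Graph
graph n r = record
  { order   = n
  ; adj     = λ i j → distinct i j ∧ (r (toℕ i) (toℕ j) ∨ r (toℕ j) (toℕ i))
  ; adj-sym = λ i j → cong₂ _∧_ (distinct-sym i j)
                        (∨-comm (r (toℕ i) (toℕ j)) (r (toℕ j) (toℕ i)))
  ; adj-irr = λ i → cong (_∧ (r (toℕ i) (toℕ i) ∨ r (toℕ i) (toℕ i))) (distinct-irr i)
  }

co : Graph → Graph
co G = record
  { order   = order G
  ; adj     = λ i j → distinct i j ∧ not (adj G i j)
  ; adj-sym = λ i j → cong₂ _∧_ (distinct-sym i j) (cong not (adj-sym G i j))
  ; adj-irr = λ i → cong (_∧ not (adj G i i)) (distinct-irr i)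
  }

infixr 6 _⊕_
infixr 7 _·_

_⊕_ : Graph → Graph → Graph
G ⊕ H = record
  { order   = order G + order H
  ; adj     = λ i j → adj⊎ (splitAt (order G) i) (splitAt (order G) j)
  ; adj-sym = λ i j → sym⊎ (splitAt (order G) i) (splitAt (order G) j)
  ; adj-irr = λ i → irr⊎ (splitAt (order G) i)
  }
  module Union where
  adj⊎ : Vertex G ⊎ Vertex H → Vertex G ⊎ Vertex H → Bool
  adj⊎ (inj₁ i) (inj₁ j) = adj G i j
  adj⊎ (inj₁ _) (inj₂ _) = false
  adj⊎ (inj₂ _) (inj₁ _) = false
  adj⊎ (inj₂ i) (inj₂ j) = adj H i j

  sym⊎ : ∀ x y → adj⊎ x y ≡ adj⊎ y x
  sym⊎ (inj₁ i) (inj₁ j) = adj-sym G i j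
  sym⊎ (inj₁ _) (inj₂ _) = refl
  sym⊎ (inj₂ _) (inj₁ _) = refl
  sym⊎ (inj₂ i) (inj₂ j) = adj-sym H i j

  irr⊎ : ∀ x → adj⊎ x x ≡ false
  irr⊎ (inj₁ i) = adj-irr G i
  irr⊎ (inj₂ i) = adj-irr H i

K : ℕ → Graph
K t = graph t λ _ _ → true

P : ℕ → Graph
P t = graph t λ i j → j ≡ᵇ suc i

-- A cycle only for t ≥ 3.
C : (t : ℕ) .{{_ : NonZero t}} → Graph
C t = graph t λ i j → j ≡ᵇ suc i % t

K[_,_] : ℕ → ℕ → Graph
K[ s , t ] = graph (s + t) λ i j → (i <ᵇ s) ∧ (s ≤ᵇ j)

_·_ : ℕ → Graph → Graph
zero  · G = K 0
suc r · G = G ⊕ r · G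

-- The vertex 0 is the vertex of degree 3; the three legs are 1, …, h and
-- h + 1, …, h + i and h + i + 1, …, h + i + j, numbered outwards.  Every vertex
-- other than 0 is joined to its parent.
S[_,_,_] : ℕ → ℕ → ℕ → Graph
S[ h , i , j ] = graph (suc (h + i + j)) λ a b → a ≡ᵇ parent b
  module Claw where
  parent : ℕ → ℕ
  parent b with (b ≡ᵇ suc h) ∨ (b ≡ᵇ suc (h + i))
  ... | true  = 0
  ... | false = pred b

paw diamond gem : Graph
paw     = co (P 1 ⊕ P 3)
diamond = co (2 · P 1 ⊕ P 2)
gem     = co (P 1 ⊕ P 4)

GraphClass : Set₁
GraphClass = Pred Graph 0ℓ

Reachable : (G : Graph) → Rel (Vertex G) 0ℓ
Reachable G = Star (Adjacent G)

-- D is isomorphic to the connected component of G containing v: it embeds in G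
-- as the subgraph induced by the vertices reachable from v.
IsComponentAt : Graph → (G : Graph) → Vertex G → Set
IsComponentAt D G v = Σ (D ⊆ᵢ G) λ (f , _) →
  ∀ u → (∃[ i ] Injection.to f i ≡ u) ⇔ Reachable G v u

IsPath : GraphClass
IsPath D = ∃[ t ] 1 ≤ t × D ≅ P t

IsSubdividedClaw : GraphClass
IsSubdividedClaw D = ∃[ h ] ∃[ i ] ∃[ j ] 1 ≤ h × h ≤ i × i ≤ j × D ≅ S[ h , i , j ]

𝒮 : GraphClass
𝒮 G = ∀ (v : Vertex G) → ∃[ D ] IsComponentAt D G v × (IsSubdividedClaw D ⊎ IsPath D)

co-𝒮 : GraphClass
co-𝒮 G = ∃[ H ] H ∈ 𝒮 × G ≅ co H

Free : Graph → Graph → GraphClass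
Free H₁ H₂ G = ¬ (H₁ ⊆ᵢ G) × ¬ (H₂ ⊆ᵢ G)

Pair : Set
Pair = Graph × Graph

infix 4 _≋_ _⟶_ _∼_

-- Equality of unordered pairs of graphs up to isomorphism.
_≋_ : Rel Pair 0ℓ
(H₁ , H₂) ≋ (H₃ , H₄) = (H₁ ≅ H₃ × H₂ ≅ H₄) ⊎ (H₁ ≅ H₄ × H₂ ≅ H₃)

data _⟶_ : Rel Pair 0ℓ where
  same       : ∀ {p q} → p ≋ q → p ⟶ q
  complement : ∀ {H₁ H₂} → (H₁ , H₂) ⟶ (co H₁ , co H₂)
  3P₁⇒P₁+P₃  : ∀ {H} → (3 · P 1 , H) ⟶ (P 1 ⊕ P 3 , H)
  P₁+P₃⇒3P₁  : ∀ {H} → (P 1 ⊕ P 3 , H) ⟶ (3 · P 1 , H)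

-- p ∼ (F₁ , F₂): the classes of p-free and of (F₁ , F₂)-free graphs are equivalent.
_∼_ : Rel Pair 0ℓ
_∼_ = Star _⟶_

data BoundedCase (F₁ F₂ : Graph) : Set where
  P₄-case      : F₁ ⊆ᵢ P 4 ⊎ F₂ ⊆ᵢ P 4 → BoundedCase F₁ F₂
  Ramsey-case  : (∃[ s ] ∃[ t ] 1 ≤ s × 1 ≤ t × F₁ ≅ K s × F₂ ≅ t · P 1) → BoundedCase F₁ F₂
  paw-case     : F₁ ⊆ᵢ paw →
                 F₂ ⊆ᵢ-some (K[ 1 , 3 ] ⊕ 3 · P 1
                            ∷ K[ 1 , 3 ] ⊕ P 2
                            ∷ P 1 ⊕ P 2 ⊕ P 3
                            ∷ P 1 ⊕ P 5
                            ∷ P 1 ⊕ S[ 1 , 1 , 2 ]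
                            ∷ P 2 ⊕ P 4
                            ∷ P 6
                            ∷ S[ 1 , 1 , 3 ]
                            ∷ S[ 1 , 2 , 2 ]
                            ∷ []) →
                 BoundedCase F₁ F₂
  diamond-case : F₁ ⊆ᵢ diamond →
                 F₂ ⊆ᵢ-some (P 1 ⊕ 2 · P 2 ∷ 3 · P 1 ⊕ P 2 ∷ P 2 ⊕ P 3 ∷ []) →
                 BoundedCase F₁ F₂
  gem-case     : F₁ ⊆ᵢ gem →
                 F₂ ⊆ᵢ-some (P 1 ⊕ P 4 ∷ P 5 ∷ []) →
                 BoundedCase F₁ F₂
  K₃+P₁-case   : F₁ ⊆ᵢ K 3 ⊕ P 1 → F₂ ⊆ᵢ K[ 1 , 3 ] → BoundedCase F₁ F₂
  2P₁+P₃-case  : F₁ ⊆ᵢ co (2 · P 1 ⊕ P 3) → F₂ ⊆ᵢ 2 · P 1 ⊕ P 3 → BoundedCase F₁ F₂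

data UnboundedCase (F₁ F₂ : Graph) : Set where
  𝒮-case       : F₁ ∉ 𝒮 → F₂ ∉ 𝒮 → UnboundedCase F₁ F₂
  co-𝒮-case    : F₁ ∉ co-𝒮 → F₂ ∉ co-𝒮 → UnboundedCase F₁ F₂
  K₃+P₁-case   : F₁ ⊇ᵢ K 3 ⊕ P 1 →
                 F₂ ⊇ᵢ-some (4 · P 1 ∷ 2 · P 2 ∷ []) →
                 UnboundedCase F₁ F₂
  diamond-case : F₁ ⊇ᵢ diamond →
                 F₂ ⊇ᵢ-some (K[ 1 , 3 ] ∷ 5 · P 1 ∷ P 2 ⊕ P 4 ∷ []) →
                 UnboundedCase F₁ F₂
  K₃-case      : F₁ ⊇ᵢ K 3 →
                 F₂ ⊇ᵢ-some (2 · P 1 ⊕ 2 · P 2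
                            ∷ 2 · P 1 ⊕ P 4
                            ∷ 4 · P 1 ⊕ P 2
                            ∷ 3 · P 2
                            ∷ 2 · P 3
                            ∷ []) →
                 UnboundedCase F₁ F₂
  K₄-case      : F₁ ⊇ᵢ K 4 →
                 F₂ ⊇ᵢ-some (P 1 ⊕ P 4 ∷ 3 · P 1 ⊕ P 2 ∷ 2 · P 2 ∷ []) →
                 UnboundedCase F₁ F₂
  gem-case     : F₁ ⊇ᵢ gem → F₂ ⊇ᵢ P 1 ⊕ 2 · P 2 → UnboundedCase F₁ F₂

data AtomUnboundedCase (F₁ F₂ : Graph) : Set where
  diamond-case : F₁ ⊇ᵢ diamond → F₂ ⊇ᵢ P 1 ⊕ P 6 → AtomUnboundedCase F₁ F₂
  2P₁+P₂-case  : F₁ ⊇ᵢ 2 · P 1 ⊕ P 2 → F₂ ⊇ᵢ co (P 6) → AtomUnboundedCase F₁ F₂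
  gem-case     : F₁ ⊇ᵢ gem → F₂ ⊇ᵢ P 6 → AtomUnboundedCase F₁ F₂
  P₁+2P₂-P₆-case :
                 F₁ ⊇ᵢ-some (P 1 ⊕ 2 · P 2 ∷ P 6 ∷ []) →
                 F₂ ⊇ᵢ-some (co (P 1 ⊕ 2 · P 2) ∷ co (P 2 ⊕ P 3) ∷ []) →
                 AtomUnboundedCase F₁ F₂
  2P₂-case     : F₁ ⊇ᵢ 2 · P 2 →
                 F₂ ⊇ᵢ-some (co (P 2 ⊕ P 4) ∷ co (3 · P 2) ∷ co (P 5) ∷ []) →
                 AtomUnboundedCase F₁ F₂

ConditionA ConditionB ConditionC ConditionD : Graph → Graph → Set
ConditionA H₁ H₂ = ∃[ F₁ ] ∃[ F₂ ] (H₁ , H₂) ∼ (F₁ , F₂) × BoundedCase F₁ F₂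
ConditionB H₁ H₂ = Free H₁ H₂ ⊆ Free (P 6) (co (2 · P 2))
                 ⊎ Free H₁ H₂ ⊆ Free (2 · P 2) (co (P 2 ⊕ P 3))
ConditionC H₁ H₂ = ∃[ F₁ ] ∃[ F₂ ] (H₁ , H₂) ∼ (F₁ , F₂) × UnboundedCase F₁ F₂
ConditionD H₁ H₂ = ∃[ F₁ ] ∃[ F₂ ] Free F₁ F₂ ⊆ Free H₁ H₂ × AtomUnboundedCase F₁ F₂

openPairs : List Pair
openPairs =
    (diamond , P 6)
  ∷ (C 4 , P 1 ⊕ 2 · P 2)
  ∷ (C 4 , P 2 ⊕ P 4)
  ∷ (C 4 , 3 · P 2)
  ∷ (co (P 1 ⊕ 2 · P 2) , 2 · P 2)
  ∷ (co (P 1 ⊕ 2 · P 2) , P 2 ⊕ P 3)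
  ∷ (co (P 1 ⊕ 2 · P 2) , P 5)
  ∷ (co (P 2 ⊕ P 3) , P 2 ⊕ P 3)
  ∷ (co (P 2 ⊕ P 3) , P 5)
  ∷ (K 3 , P 1 ⊕ S[ 1 , 1 , 3 ])
  ∷ (K 3 , S[ 1 , 2 , 3 ])
  ∷ (3 · P 1 , co (P 1 ⊕ S[ 1 , 1 , 3 ]))
  ∷ (diamond , P 1 ⊕ P 2 ⊕ P 3)
  ∷ (diamond , P 1 ⊕ P 5)
  ∷ (2 · P 1 ⊕ P 2 , co (P 1 ⊕ P 2 ⊕ P 3))
  ∷ (2 · P 1 ⊕ P 2 , co (P 1 ⊕ P 5))
  ∷ (gem , P 2 ⊕ P 3)
  ∷ (P 1 ⊕ P 4 , co (P 2 ⊕ P 3))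
  ∷ []

module Submission where

-- A graph in 𝒮 has no connected induced subgraph with minimum degree 2, with a vertex of
-- degree 4 or with two vertices of degree 3.  If (C) fails, one of H₁, H₂ lies in 𝒮 and one in
-- co-𝒮.  A graph in both classes is an induced subgraph of P₄, which is covered by (A), so up to
-- symmetry X = H₁ and Y = co H₂ both lie in 𝒮.  If Y contains 3P₁, then the K₃-case of (C)
-- leaves only finitely many X with an edge, all of which arise from P₂ by adding vertices one at
-- a time; if Y does not contain 3P₁, then Y lies in P₄ or contains 2P₂, and (C) leaves even
-- fewer.  It remains to decide finitely many pairs (X , Y), and an edgeless X with at least five
-- vertices behaves like 5P₁.  Conversely, the pairs equivalent to a pair in (E) are, up to
-- isomorphism, few, and none of them satisfies a case of (A) or (C); for (B) and (D) the
-- inclusions of classes are refuted by a single graph each.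

open import Defs
open import Data.Bool using (Bool; T; T?; _∧_; _∨_; false; if_then_else_; not; true)
import Data.Bool.Properties as Bool
open import Data.Bool.Properties using (T-∧; T-∨; T-≡; not-involutive; ¬-not)
open import Data.Empty using (⊥; ⊥-elim)
open import Data.Fin using (Fin; _≟_; _↑ʳ_; _↑ˡ_; cast; fromℕ<; splitAt; suc; toℕ; zero)
open import Data.Fin.Properties
  using (all?; any?; cast-involutive; injective⇒≤; splitAt-↑ʳ; splitAt-↑ˡ; splitAt⁻¹-↑ʳ;
         splitAt⁻¹-↑ˡ; toℕ-injective; ¬∀⟶∃¬; ↑ʳ-injective; ↑ˡ-injective)
import Data.List as List
open import Data.List using (List; []; _++_; _∷_; allFin; filter; length; map)
open import Data.List.Membership.Propositional using (_∈_; find; lose)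
open import Data.List.Membership.Propositional.Properties using (∈-filter⁻; ∈-lookup)
open import Data.List.Relation.Unary.All as All using (All; []; _∷_)
open import Data.List.Relation.Unary.AllPairs using ([]; _∷_)
open import Data.List.Relation.Unary.Any as Any using (Any; here; there)
import Data.List.Relation.Unary.Any.Properties as Any
open import Data.List.Relation.Unary.Any.Properties using (lookup-index)
open import Data.List.Relation.Unary.Unique.Propositional using (Unique)
import Data.List.Relation.Unary.Unique.Propositional.Properties as Unique
open import Data.Maybe using (Maybe; fromMaybe; just; nothing)
open import Data.Nat using (_+_; _<_; _<ᵇ_; _≡ᵇ_; _≤_; _≤ᵇ_; pred; suc; s≤s; zero; z≤n; ℕ)
import Data.Nat.Properties as ℕ
open import Data.Product as Product using (_,_; _×_; proj₁; proj₂; Σ; ∃; ∃-syntax)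
open import Data.Product.Function.NonDependent.Propositional using (_×-⇔_)
open import Data.Sum as Sum using ([_,_]′; _⊎_; inj₁; inj₂)
open import Data.Unit using (tt; ⊤)
open import Data.Vec using (Vec; []; _∷_; lookup; tabulate)
open import Data.Vec.Properties using (lookup∘tabulate)
open import Function using (_∘_; id)
open import Function.Bundles using (Equivalence; Injection; Inverse; _⇔_; mk↔ₛ′; mk↣; mk⇔)
open import Function.Construct.Composition using (_↔-∘_; _↣-∘_; _⇔-∘_)
open import Function.Construct.Identity using (↔-id; ↣-id; ⇔-id)
open import Function.Properties.Inverse using (↔-sym; ↔⇒↣)
open import Relation.Binary.Construct.Closure.ReflexiveTransitive
  using (_◅_; _◅◅_; gmap; reverse; ε)
open import Relation.Binary.PropositionalEquality
  using (_≡_; _≢_; cong; cong₂; refl; subst; sym; trans)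
open import Relation.Nullary using (Dec; contradiction; does; no; yes; ¬_)
open import Relation.Nullary.Decidable
  using (True; _×-dec_; _→-dec_; _⊎-dec_; map′; toWitness; ¬?)

-- Induced subgraphs and isomorphisms

-- The conditions quantify over infinitely many graphs, so each direction reduces them to finitely
-- many decidable tests. Forwards, the cases become data, rewritten for the pair (`H₁`, `co H₂`); a
-- witness for (A) or (C) is always the given pair or its complement, in either order. The
-- hypotheses of the theorem enter as further rules: `P 1 ⊕ P 3` and `paw` are excluded, and so is
-- (`3 · P 1`, `co S[ 1 , 2 , 3 ]`), whose complement is the open pair (`K 3`, `S[ 1 , 2 , 3 ]`).
-- Membership in `𝒮` is never decided: a finite list of obstructions refutes it, and a list of
-- samples certifies it for the graphs of (E). Backwards, `_∼_` is controlled by an invariant: up to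
-- complementing the pair, one graph stays in one short list and the other in a second.

⊆ᵢ-refl : ∀ {G} → G ⊆ᵢ G
⊆ᵢ-refl = ↣-id _ , λ _ _ → refl

⊆ᵢ-trans : ∀ {F G H} → F ⊆ᵢ G → G ⊆ᵢ H → F ⊆ᵢ H
⊆ᵢ-trans (f , f-adj) (g , g-adj) = g ↣-∘ f , λ i j → trans (f-adj i j) (g-adj _ _)

≅-refl : ∀ {G} → G ≅ G
≅-refl = ↔-id _ , λ _ _ → refl

≅-trans : ∀ {F G H} → F ≅ G → G ≅ H → F ≅ H
≅-trans (f , f-adj) (g , g-adj) = g ↔-∘ f , λ i j → trans (f-adj i j) (g-adj _ _)

≅-sym : ∀ {G H} → G ≅ H → H ≅ G
≅-sym {H = H} (f , f-adj) = ↔-sym f , λ i j → sym (trans (f-adj _ _)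
  (cong₂ (adj H) (Inverse.strictlyInverseˡ f i) (Inverse.strictlyInverseˡ f j)))

≅⇒⊆ᵢ : ∀ {G H} → G ≅ H → G ⊆ᵢ H
≅⇒⊆ᵢ (f , f-adj) = ↔⇒↣ f , f-adj

≅⇒⊇ᵢ : ∀ {G H} → G ≅ H → G ⊇ᵢ H
≅⇒⊇ᵢ {G} {H} G≅H = ≅⇒⊆ᵢ {H} {G} (≅-sym {G} {H} G≅H)

⊆ᵢ⇒order≤ : ∀ {F G} → F ⊆ᵢ G → order F ≤ order G
⊆ᵢ⇒order≤ (f , _) = injective⇒≤ (Injection.injective f)

co-adj : ∀ G {i j} → i ≢ j → adj (co G) i j ≡ not (adj G i j)
co-adj G {i} {j} i≢j with i ≟ j
... | yes i≡j = contradiction i≡j i≢j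
... | no  _   = refl

co-mono : ∀ {F G} → F ⊆ᵢ G → co F ⊆ᵢ co G
co-mono {F} {G} (f , f-adj) = f , co-f-adj
  where
  co-f-adj : ∀ i j → adj (co F) i j ≡ adj (co G) (Injection.to f i) (Injection.to f j)
  co-f-adj i j with i ≟ j
  ... | yes refl = sym (adj-irr (co G) _)
  ... | no  i≢j  = trans (cong not (f-adj i j)) (sym (co-adj G (i≢j ∘ Injection.injective f)))

co-cong : ∀ {G H} → G ≅ H → co G ≅ co H
co-cong {G} {H} G≅H = proj₁ G≅H , proj₂ (co-mono {G} {H} (≅⇒⊆ᵢ {G} {H} G≅H))

co-involutive : ∀ G → co (co G) ≅ G
co-involutive G = ↔-id _ , co-co-adj
  where
  co-co-adj : ∀ i j → adj (co (co G)) i j ≡ adj G i j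
  co-co-adj i j with i ≟ j
  ... | yes refl = sym (adj-irr G i)
  ... | no  _    = not-involutive _

-- A graph is encoded by the rows of its adjacency matrix above the diagonal, so
-- that deciding F ⊆ᵢ G does not evaluate the definitions of F and G repeatedly.

data Code : ℕ → Set where
  []  : Code 0
  _∷_ : ∀ {n} → Vec Bool n → Code n → Code (suc n)

-- The value `nothing` marks the diagonal, so a map that preserves `rel` is automatically injective
-- and needs no separate check.
rel : ∀ {n} → Code n → Fin n → Fin n → Maybe Bool
rel (r ∷ c) zero    zero    = nothing
rel (r ∷ c) zero    (suc j) = just (lookup r j)
rel (r ∷ c) (suc i) zero    = just (lookup r i)
rel (r ∷ c) (suc i) (suc j) = rel c i j

rel-sym : ∀ {n} (c : Code n) i j → rel c i j ≡ rel c j i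
rel-sym (r ∷ c) zero    zero    = refl
rel-sym (r ∷ c) zero    (suc j) = refl
rel-sym (r ∷ c) (suc i) zero    = refl
rel-sym (r ∷ c) (suc i) (suc j) = rel-sym c i j

rel-diagonal : ∀ {n} (c : Code n) i → rel c i i ≡ nothing
rel-diagonal (r ∷ c) zero    = refl
rel-diagonal (r ∷ c) (suc i) = rel-diagonal c i

rel-nothing : ∀ {n} (c : Code n) {i j} → rel c i j ≡ nothing → i ≡ j
rel-nothing (r ∷ c) {zero}  {zero}  _  = refl
rel-nothing (r ∷ c) {suc i} {suc j} eq = cong suc (rel-nothing c eq)

⟦_⟧ : ∀ {n} → Code n → Graph
⟦ c ⟧ = record
  { order   = _
  ; adj     = λ i j → fromMaybe false (rel c i j)
  ; adj-sym = λ i j → cong (fromMaybe false) (rel-sym c i j)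
  ; adj-irr = λ i → cong (fromMaybe false) (rel-diagonal c i)
  }

rel-just : ∀ {n} (c : Code n) {i j} → i ≢ j → rel c i j ≡ just (adj ⟦ c ⟧ i j)
rel-just c {i} {j} i≢j with rel c i j in eq
... | just _  = refl
... | nothing = contradiction (rel-nothing c eq) i≢j

encode : ∀ {n} → (Fin n → Fin n → Bool) → Code n
encode {zero}  a = []
encode {suc n} a = tabulate (a zero ∘ suc) ∷ encode (λ i j → a (suc i) (suc j))

rel-encode : ∀ {n} (a : Fin n → Fin n → Bool) → (∀ i j → a i j ≡ a j i) →
             ∀ {i j} → i ≢ j → rel (encode a) i j ≡ just (a i j)
rel-encode a a-sym {zero}  {zero}  0≢0 = contradiction refl 0≢0
rel-encode a a-sym {zero}  {suc j} _   = cong just (lookup∘tabulate _ j)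
rel-encode a a-sym {suc i} {zero}  _   = cong just (trans (lookup∘tabulate _ i) (a-sym _ _))
rel-encode a a-sym {suc i} {suc j} i≢j = rel-encode _ (λ _ _ → a-sym _ _) (i≢j ∘ cong suc)

code : (G : Graph) → Code (order G)
code G = encode (adj G)

code-correct : ∀ G → ⟦ code G ⟧ ≅ G
code-correct G = ↔-id _ , same-adj
  where
  same-adj : ∀ i j → adj ⟦ code G ⟧ i j ≡ adj G i j
  same-adj i j with i ≟ j
  ... | yes refl = trans (adj-irr ⟦ code G ⟧ i) (sym (adj-irr G i))
  ... | no  i≢j  = cong (fromMaybe false) (rel-encode (adj G) (adj-sym G) i≢j)

is-just : Bool → Maybe Bool → Bool
is-just _     nothing  = false
is-just true  (just b) = b
is-just false (just b) = not b

is-just-correct : ∀ b m → T (is-just b m) ⇔ m ≡ just b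
is-just-correct _     nothing      = mk⇔ (λ ()) (λ ())
is-just-correct true  (just true)  = mk⇔ (λ _ → refl) (λ _ → tt)
is-just-correct true  (just false) = mk⇔ (λ ()) (λ ())
is-just-correct false (just true)  = mk⇔ (λ ()) (λ ())
is-just-correct false (just false) = mk⇔ (λ _ → refl) (λ _ → tt)

some : ∀ {n} → (Fin n → Bool) → Bool
some {zero}  p = false
some {suc n} p = p zero ∨ some (p ∘ suc)

some-correct : ∀ {n} {p : Fin n → Bool} → T (some p) ⇔ (∃[ i ] T (p i))
some-correct {zero}  = mk⇔ (λ ()) (λ ())
some-correct {suc n} {p} = mk⇔ to from
  where
  to : T (some p) → ∃[ i ] T (p i)
  to t with Equivalence.to T-∨ t
  ... | inj₁ p₀ = zero , p₀
  ... | inj₂ t′ with Equivalence.to some-correct t′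
  ... | i , pᵢ  = suc i , pᵢ

  from : ∃[ i ] T (p i) → T (some p)
  from (zero  , p₀) = Equivalence.from T-∨ (inj₁ p₀)
  from (suc i , pᵢ) = Equivalence.from (T-∨ {p zero}) (inj₂ (Equivalence.from some-correct (i , pᵢ)))

module _ {n} (G : Code n) where

  Fits : ∀ {m} → Vec Bool m → Vec (Fin n) m → Fin n → Set
  Fits []      []      w = ⊤
  Fits (b ∷ r) (x ∷ f) w = rel G w x ≡ just b × Fits r f w

  Embeds : ∀ {m} → Code m → Vec (Fin n) m → Set
  Embeds []      []      = ⊤
  Embeds (r ∷ c) (w ∷ f) = Fits r f w × Embeds c f

  Fits-lookup : ∀ {m} (r : Vec Bool m) f {w} → Fits r f w →
                ∀ i → rel G w (lookup f i) ≡ just (lookup r i)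
  Fits-lookup (b ∷ r) (x ∷ f) (p , _) zero    = p
  Fits-lookup (b ∷ r) (x ∷ f) (_ , q) (suc i) = Fits-lookup r f q i

  Fits-tabulate : ∀ {m} (r : Vec Bool m) f {w} →
                  (∀ i → rel G w (lookup f i) ≡ just (lookup r i)) → Fits r f w
  Fits-tabulate []      []      p = tt
  Fits-tabulate (b ∷ r) (x ∷ f) p = p zero , Fits-tabulate r f (p ∘ suc)

  Embeds-rel : ∀ {m} (F : Code m) f → Embeds F f →
               ∀ i j → rel F i j ≡ rel G (lookup f i) (lookup f j)
  Embeds-rel (r ∷ F) (w ∷ f) (p , q) zero    zero    = sym (rel-diagonal G w)
  Embeds-rel (r ∷ F) (w ∷ f) (p , q) zero    (suc j) = sym (Fits-lookup r f p j)
  Embeds-rel (r ∷ F) (w ∷ f) (p , q) (suc i) zero    =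
    trans (sym (Fits-lookup r f p i)) (rel-sym G w _)
  Embeds-rel (r ∷ F) (w ∷ f) (p , q) (suc i) (suc j) = Embeds-rel F f q i j

  rel-Embeds : ∀ {m} (F : Code m) f →
               (∀ i j → rel F i j ≡ rel G (lookup f i) (lookup f j)) → Embeds F f
  rel-Embeds []      []      p = tt
  rel-Embeds (r ∷ F) (w ∷ f) p =
    Fits-tabulate r f (λ i → sym (p zero (suc i))) , rel-Embeds F f (λ i j → p (suc i) (suc j))

  fits : ∀ {m} → Vec Bool m → Vec (Fin n) m → Fin n → Bool
  fits []      []      w = true
  fits (b ∷ r) (x ∷ f) w = is-just b (rel G w x) ∧ fits r f w

  fits-correct : ∀ {m} (r : Vec Bool m) f w → T (fits r f w) ⇔ Fits r f w
  fits-correct []      []      w = ⇔-id ⊤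
  fits-correct (b ∷ r) (x ∷ f) w =
    (is-just-correct b (rel G w x) ×-⇔ fits-correct r f w) ⇔-∘ T-∧

  -- Depth-first search with `p` as continuation: the last vertices of `F` are placed first, and
  -- every candidate `w` is tested against the vertices already placed before the search goes on.
  search : ∀ {m} → Code m → (Vec (Fin n) m → Bool) → Bool
  search []      p = p []
  search (r ∷ F) p = search F λ f → some λ w → fits r f w ∧ p (w ∷ f)

  search-correct : ∀ {m} (F : Code m) p → T (search F p) ⇔ (∃[ f ] Embeds F f × T (p f))
  search-correct []      p = mk⇔ (λ t → [] , tt , t) λ { ([] , _ , t) → t }
  search-correct (r ∷ F) p = mk⇔ to from
    where
    to : T (search (r ∷ F) p) → ∃[ f ] Embeds (r ∷ F) f × T (p f)
    to t with Equivalence.to (search-correct F _) t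
    ... | f , F↪G , t′ with Equivalence.to some-correct t′
    ... | w , t″ with Equivalence.to T-∧ t″
    ... | fit , pf = w ∷ f , (Equivalence.to (fits-correct r f w) fit , F↪G) , pf

    from : ∃[ f ] Embeds (r ∷ F) f × T (p f) → T (search (r ∷ F) p)
    from (w ∷ f , (fit , F↪G) , pf) = Equivalence.from (search-correct F _)
      (f , F↪G , Equivalence.from some-correct
        (w , Equivalence.from T-∧ (Equivalence.from (fits-correct r f w) fit , pf)))

infix 4 _⊆ᶜ?_ _⊆ᵢ?_ _≅?_

-- Through `map′` the verdict is that of a plain Boolean test, so evaluating it builds no embedding.
-- Comparing the orders first avoids hopeless searches.
_⊆ᶜ?_ : ∀ {m n} (F : Code m) (G : Code n) → Dec (⟦ F ⟧ ⊆ᵢ ⟦ G ⟧)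
_⊆ᶜ?_ {m} {n} F G =
  map′ (to ∘ Equivalence.to correct ∘ proj₂ ∘ Equivalence.to T-∧)
       (λ F⊆G → Equivalence.from T-∧
         (ℕ.≤⇒≤ᵇ (⊆ᵢ⇒order≤ {⟦ F ⟧} {⟦ G ⟧} F⊆G) , Equivalence.from correct (from F⊆G)))
       (T? ((m ≤ᵇ n) ∧ search G F (λ _ → true)))
  where
  correct = search-correct G F (λ _ → true)

  to : ∃[ f ] Embeds G F f × ⊤ → ⟦ F ⟧ ⊆ᵢ ⟦ G ⟧
  to (f , emb , _) = mk↣ inj , λ i j → cong (fromMaybe false) (rel≡ i j)
    where
    rel≡ = Embeds-rel G F f emb
    inj : ∀ {i j} → lookup f i ≡ lookup f j → i ≡ j
    inj {i} {j} eq = rel-nothing F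
      (trans (rel≡ i j) (trans (cong (rel G _) (sym eq)) (rel-diagonal G _)))

  from : ⟦ F ⟧ ⊆ᵢ ⟦ G ⟧ → ∃[ f ] Embeds G F f × ⊤
  from (f , f-adj) = tabulate (Injection.to f) , rel-Embeds G F _ rel≡ , tt
    where
    rel≡ : ∀ i j → rel F i j ≡ rel G (lookup (tabulate (Injection.to f)) i)
                                     (lookup (tabulate (Injection.to f)) j)
    rel≡ i j rewrite lookup∘tabulate (Injection.to f) i | lookup∘tabulate (Injection.to f) j
      with i ≟ j
    ... | yes refl = trans (rel-diagonal F i) (sym (rel-diagonal G _))
    ... | no  i≢j  = trans (rel-just F i≢j)
      (trans (cong just (f-adj i j)) (sym (rel-just G (i≢j ∘ Injection.injective f))))

⊆ᵢ-decode : ∀ {F G} → ⟦ code F ⟧ ⊆ᵢ ⟦ code G ⟧ → F ⊆ᵢ G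
⊆ᵢ-decode {F} {G} F⊆G =
  ⊆ᵢ-trans {F} {⟦ code F ⟧} {G} (≅⇒⊇ᵢ {⟦ code F ⟧} {F} (code-correct F))
    (⊆ᵢ-trans {⟦ code F ⟧} {⟦ code G ⟧} {G} F⊆G (≅⇒⊆ᵢ {⟦ code G ⟧} {G} (code-correct G)))

⊆ᵢ-encode : ∀ {F G} → F ⊆ᵢ G → ⟦ code F ⟧ ⊆ᵢ ⟦ code G ⟧
⊆ᵢ-encode {F} {G} F⊆G =
  ⊆ᵢ-trans {⟦ code F ⟧} {F} {⟦ code G ⟧} (≅⇒⊆ᵢ {⟦ code F ⟧} {F} (code-correct F))
    (⊆ᵢ-trans {F} {G} {⟦ code G ⟧} F⊆G (≅⇒⊇ᵢ {⟦ code G ⟧} {G} (code-correct G)))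

_⊆ᵢ?_ : (F G : Graph) → Dec (F ⊆ᵢ G)
F ⊆ᵢ? G = map′ (⊆ᵢ-decode {F} {G}) (⊆ᵢ-encode {F} {G}) (code F ⊆ᶜ? code G)

-- Classification by adding one vertex at a time

grow : ∀ {m} (F : Code m) G → ⟦ F ⟧ ⊆ᵢ G → ⟦ F ⟧ ≅ G ⊎ ∃[ r ] ⟦ r ∷ F ⟧ ⊆ᵢ G
grow {m} F G (f , f-adj) with all? (λ w → any? (λ i → Injection.to f i ≟ w))
... | yes onto = inj₁ (mk↔ₛ′ (Injection.to f) (proj₁ ∘ onto) (proj₂ ∘ onto)
                         (λ i → Injection.injective f (proj₂ (onto (Injection.to f i))))
                       , f-adj)
... | no ¬onto = inj₂ (row , mk↣ ext-inj , ext-adj)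
  where
  missed : ∃[ w ] ¬ (∃[ i ] Injection.to f i ≡ w)
  missed = ¬∀⟶∃¬ _ _ (λ w → any? (λ i → Injection.to f i ≟ w)) ¬onto

  row : Vec Bool m
  row = tabulate (λ i → adj G (proj₁ missed) (Injection.to f i))

  ext : Fin (suc m) → Vertex G
  ext zero    = proj₁ missed
  ext (suc i) = Injection.to f i

  ext-inj : ∀ {i j} → ext i ≡ ext j → i ≡ j
  ext-inj {zero}  {zero}  eq = refl
  ext-inj {zero}  {suc j} eq = contradiction (j , sym eq) (proj₂ missed)
  ext-inj {suc i} {zero}  eq = contradiction (i , eq) (proj₂ missed)
  ext-inj {suc i} {suc j} eq = cong suc (Injection.injective f eq)

  ext-adj : ∀ i j → adj ⟦ row ∷ F ⟧ i j ≡ adj G (ext i) (ext j)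
  ext-adj zero    zero    = sym (adj-irr G _)
  ext-adj zero    (suc j) = lookup∘tabulate _ j
  ext-adj (suc i) zero    = trans (lookup∘tabulate _ i) (adj-sym G _ _)
  ext-adj (suc i) (suc j) = f-adj i j

-- If the embedding of `F` missed a vertex of `G`, then a graph with one vertex more than `F` would
-- embed in `G` and hence in `F`.
⊆ᵢ-antisym : ∀ {F G} → F ⊆ᵢ G → G ⊆ᵢ F → F ≅ G
⊆ᵢ-antisym {F} {G} F⊆G G⊆F
  with grow (code F) G (⊆ᵢ-trans {⟦ code F ⟧} {F} {G} (≅⇒⊆ᵢ {⟦ code F ⟧} {F} (code-correct F)) F⊆G)
... | inj₁ F≅G        = ≅-trans {F} {⟦ code F ⟧} {G} (≅-sym {⟦ code F ⟧} {F} (code-correct F)) F≅G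
... | inj₂ (r , F⁺⊆G) = contradiction
  (⊆ᵢ⇒order≤ {⟦ r ∷ code F ⟧} {F} (⊆ᵢ-trans {⟦ r ∷ code F ⟧} {G} {F} F⁺⊆G G⊆F)) ℕ.1+n≰n

_≅?_ : (F G : Graph) → Dec (F ≅ G)
F ≅? G = map′ (λ (F⊆G , G⊆F) → ⊆ᵢ-antisym {F} {G} F⊆G G⊆F)
              (λ F≅G → ≅⇒⊆ᵢ {F} {G} F≅G , ≅⇒⊇ᵢ {F} {G} F≅G)
              ((F ⊆ᵢ? G) ×-dec (G ⊆ᵢ? F))

all-rows? : ∀ n {P : Vec Bool n → Set} → (∀ r → Dec (P r)) → Dec (∀ r → P r)
all-rows? zero    P? = map′ (λ { p [] → p }) (λ p → p []) (P? [])
all-rows? (suc n) P? =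
  map′ (λ { (t , f) (true ∷ r) → t r ; (t , f) (false ∷ r) → f r })
       (λ p → p ∘ (true ∷_) , p ∘ (false ∷_))
       (all-rows? n (P? ∘ (true ∷_)) ×-dec all-rows? n (P? ∘ (false ∷_)))

-- The condition n < m makes the growth in classify end.
Closed : (Fs Gs : List (∃ Code)) → Set
Closed Fs Gs = All (λ (n , G) → ∀ r → Any (λ (_ , F) → ⟦ F ⟧ ⊆ᵢ ⟦ r ∷ G ⟧) Fs
                                    ⊎ Any (λ (m , H) → n < m × ⟦ H ⟧ ⊆ᵢ ⟦ r ∷ G ⟧) Gs) Gs

closed? : ∀ Fs Gs → Dec (Closed Fs Gs)
closed? Fs Gs = All.all? (λ (n , G) → all-rows? n λ r →
  Any.any? (λ (_ , F) → F ⊆ᶜ? (r ∷ G)) Fs ⊎-dec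
  Any.any? (λ (m , H) → (n ℕ.<? m) ×-dec (H ⊆ᶜ? (r ∷ G))) Gs) Gs

module _ {Fs Gs : List (∃ Code)} (closed : Closed Fs Gs) (G : Graph)
         (free : ¬ Any (λ (_ , F) → ⟦ F ⟧ ⊆ᵢ G) Fs) where

  classify : Any (λ (_ , H) → ⟦ H ⟧ ⊆ᵢ G) Gs → Any (λ (_ , H) → ⟦ H ⟧ ≅ G) Gs
  classify = grow-to-G (suc (order G)) ∘ Any.map (λ H⊆G → ℕ.m≤n+m _ _ , H⊆G)
    where
    -- The fuel `k` bounds the remaining growth steps: one step lowers `k` by one and raises the
    -- order of `H` by at least one, which keeps `order G < n + k`. At `k = 0` the graph `H` would
    -- be larger than `G`.
    grow-to-G : ∀ k → Any (λ (n , H) → order G < n + k × ⟦ H ⟧ ⊆ᵢ G) Gs →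
                Any (λ (_ , H) → ⟦ H ⟧ ≅ G) Gs
    grow-to-G k any with find any
    ... | (n , H) , H∈ , n+k>G , H⊆G with grow H G H⊆G | k
    ... | inj₁ H≅G         | _     = lose H∈ H≅G
    ... | inj₂ _           | zero  = contradiction (⊆ᵢ⇒order≤ {⟦ H ⟧} {G} H⊆G)
                                       (ℕ.<⇒≱ (subst (order G <_) (ℕ.+-identityʳ n) n+k>G))
    ... | inj₂ (r , H⁺⊆G)  | suc k with All.lookup closed H∈ r
    ... | inj₁ F⊆H⁺  = contradiction
      (Any.map (λ {(_ , F)} F⊆ → ⊆ᵢ-trans {⟦ F ⟧} {⟦ r ∷ H ⟧} {G} F⊆ H⁺⊆G) F⊆H⁺) free
    ... | inj₂ H′⊆H⁺ = grow-to-G k (Any.map (λ {(m , H′)} (n<m , H′⊆) →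
        ℕ.≤-trans n+k>G (ℕ.≤-trans (ℕ.≤-reflexive (ℕ.+-suc n k)) (ℕ.+-monoˡ-≤ k n<m))
      , ⊆ᵢ-trans {⟦ H′ ⟧} {⟦ r ∷ H ⟧} {G} H′⊆ H⁺⊆G) H′⊆H⁺)

-- Degrees, and induced subgraphs of paths and subdivided claws

Adjacent? : ∀ G (i j : Vertex G) → Dec (Adjacent G i j)
Adjacent? G i j = adj G i j Bool.≟ true

neighbours : ∀ G → Vertex G → List (Vertex G)
neighbours G v = filter (Adjacent? G v) (allFin (order G))

degree : ∀ G → Vertex G → ℕ
degree G v = length (neighbours G v)

-- The common structure of P t and S[ h , i , j ], as trees rooted at 0.
record Spider (G : Graph) : Set where
  field
    parent        : ℕ → ℕ
    parent≤       : ∀ b → parent b ≤ b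
    edge          : ∀ {i j} → Adjacent G i j → toℕ i ≡ parent (toℕ j) ⊎ toℕ j ≡ parent (toℕ i)
    legs          : ∀ {b c} → b ≢ 0 → b ≡ parent c → c ≡ suc b
    feet          : List ℕ
    at-most-3     : length feet ≤ 3
    children-of-0 : ∀ {c} → c ≢ 0 → 0 ≡ parent c → c ∈ feet

graph-edge : ∀ n r (i j : Fin n) → Adjacent (graph n r) i j →
             T (r (toℕ i) (toℕ j)) ⊎ T (r (toℕ j) (toℕ i))
graph-edge n r i j e =
  Equivalence.to T-∨ (proj₂ (Equivalence.to (T-∧ {distinct i j}) (Equivalence.from T-≡ e)))

path-spider : ∀ t → Spider (P t)
path-spider t = record
  { parent = pred
  ; parent≤ = λ b → ℕ.pred[n]≤n
  ; edge = λ {i} {j} e → [ (λ t → inj₁ (sym (cong pred (ℕ.≡ᵇ⇒≡ (toℕ j) _ t))))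
                         , (λ t → inj₂ (sym (cong pred (ℕ.≡ᵇ⇒≡ (toℕ i) _ t)))) ]′
                         (graph-edge t (λ a b → b ≡ᵇ suc a) i j e)
  ; legs = λ { {c = zero} b≢0 refl → contradiction refl b≢0 ; {c = suc c} _ refl → refl }
  ; feet = 1 ∷ []
  ; at-most-3 = s≤s z≤n
  ; children-of-0 = λ { {zero} c≢0 _ → contradiction refl c≢0 ; {suc zero} _ _ → here refl }
  }

module _ (h i j : ℕ) where

  open Claw h i j using (parent)

  parent-cases : ∀ b → parent b ≡ 0 × (b ≡ suc h ⊎ b ≡ suc (h + i)) ⊎ parent b ≡ pred b
  parent-cases b with (b ≡ᵇ suc h) ∨ (b ≡ᵇ suc (h + i)) in eq
  ... | false = inj₂ refl
  ... | true  = inj₁ (refl , [ inj₁ ∘ ℕ.≡ᵇ⇒≡ _ _ , inj₂ ∘ ℕ.≡ᵇ⇒≡ _ _ ]′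
                               (Equivalence.to T-∨ (Equivalence.from T-≡ eq)))

  claw-spider : Spider S[ h , i , j ]
  claw-spider = record
    { parent = parent
    ; parent≤ = parent≤
    ; edge = λ {u} {v} e → [ inj₁ ∘ ℕ.≡ᵇ⇒≡ (toℕ u) _ , inj₂ ∘ ℕ.≡ᵇ⇒≡ (toℕ v) _ ]′
                           (graph-edge _ (λ a b → a ≡ᵇ parent b) u v e)
    ; legs = legs
    -- The first vertices of the three legs; no other nonzero vertex has parent `0`.
    ; feet = 1 ∷ suc h ∷ suc (h + i) ∷ []
    ; at-most-3 = ℕ.≤-refl
    ; children-of-0 = children
    }
    where
    parent≤ : ∀ b → parent b ≤ b
    parent≤ b with parent-cases b
    ... | inj₁ (p≡0 , _) = subst (_≤ b) (sym p≡0) z≤n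
    ... | inj₂ p≡pred    = subst (_≤ b) (sym p≡pred) ℕ.pred[n]≤n

    legs : ∀ {b c} → b ≢ 0 → b ≡ parent c → c ≡ suc b
    legs {b} {c} b≢0 b≡p with parent-cases c
    ... | inj₁ (p≡0 , _) = contradiction (trans b≡p p≡0) b≢0
    ... | inj₂ p≡pred with c
    ... | zero  = contradiction (trans b≡p p≡pred) b≢0
    ... | suc c = cong suc (sym (trans b≡p p≡pred))

    children : ∀ {c} → c ≢ 0 → 0 ≡ parent c → c ∈ 1 ∷ suc h ∷ suc (h + i) ∷ []
    children {c} c≢0 0≡p with parent-cases c
    ... | inj₁ (_ , inj₁ c≡) = there (here c≡)
    ... | inj₁ (_ , inj₂ c≡) = there (there (here c≡))
    ... | inj₂ p≡pred with c
    ... | zero        = contradiction refl c≢0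
    ... | suc zero    = here refl
    ... | suc (suc c) with () ← trans 0≡p p≡pred

-- These patterns capture, in turn, cycles, stars with four leaves, and trees with two branch
-- vertices. They speak of degrees only, so they are decidable and need no isomorphism with a
-- particular graph.
Unspidery : Graph → Set
Unspidery F = (0 < order F × (∀ v → 2 ≤ degree F v))
            ⊎ (∃[ v ] 4 ≤ degree F v)
            ⊎ (∃[ u ] ∃[ v ] u ≢ v × 3 ≤ degree F u × 3 ≤ degree F v)

unspidery? : ∀ F → Dec (Unspidery F)
unspidery? F = ((0 ℕ.<? order F) ×-dec all? (λ v → 2 ℕ.≤? degree F v))
         ⊎-dec any? (λ v → 4 ℕ.≤? degree F v)
         ⊎-dec any? (λ u → any? λ v → ¬? (u ≟ v) ×-dec (3 ℕ.≤? degree F u) ×-dec (3 ℕ.≤? degree F v))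

argmax : ∀ {n} → 0 < n → (f : Fin n → ℕ) → ∃[ i ] ∀ j → f j ≤ f i
argmax {suc zero}    _ f = zero , λ { zero → ℕ.≤-refl }
argmax {suc (suc n)} _ f with argmax (s≤s z≤n) (f ∘ suc)
... | i , max with ℕ.≤-total (f zero) (f (suc i))
... | inj₁ f0≤ = suc i , λ { zero → f0≤ ; (suc j) → max j }
... | inj₂ ≤f0 = zero  , λ { zero → ℕ.≤-refl ; (suc j) → ℕ.≤-trans (max j) ≤f0 }

lookup-injective : ∀ {A : Set} {xs : List A} → Unique xs →
                   ∀ {k l} → List.lookup xs k ≡ List.lookup xs l → k ≡ l
lookup-injective (x∉xs ∷ _)  {zero}  {zero}  _  = refl
lookup-injective (x∉xs ∷ _)  {zero}  {suc l} eq = contradiction eq (All.lookup x∉xs (∈-lookup l))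
lookup-injective (x∉xs ∷ _)  {suc k} {zero}  eq = contradiction (sym eq) (All.lookup x∉xs (∈-lookup k))
lookup-injective (_ ∷ unique) {suc k} {suc l} eq = cong suc (lookup-injective unique eq)

module _ {F G : Graph} (spider : Spider G) (F⊆G : F ⊆ᵢ G) where

  open Spider spider

  place : Vertex F → ℕ
  place v = toℕ (Injection.to (proj₁ F⊆G) v)

  place-injective : ∀ {u v} → place u ≡ place v → u ≡ v
  place-injective = Injection.injective (proj₁ F⊆G) ∘ toℕ-injective

  -- Sending each neighbour of `v` to the position of its place in `L` is injective, as neighbours
  -- are listed without repetition and `place` is injective.
  degree≤ : ∀ v (L : List ℕ) → (∀ u → Adjacent F v u → place u ∈ L) → degree F v ≤ length L
  degree≤ v L covers = injective⇒≤ {f = Any.index ∘ covered} index-injective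
    where
    covered : ∀ k → place (List.lookup (neighbours F v) k) ∈ L
    covered k = covers _ (proj₂ (∈-filter⁻ (Adjacent? F v) {xs = allFin _} (∈-lookup k)))
    index-injective : ∀ {k l} → Any.index (covered k) ≡ Any.index (covered l) → k ≡ l
    index-injective {k} {l} eq = lookup-injective (Unique.filter⁺ (Adjacent? F v) (Unique.allFin⁺ _))
      (place-injective (trans (lookup-index (covered k))
        (trans (cong (List.lookup L) eq) (sym (lookup-index (covered l))))))

  place-edge : ∀ {u v} → Adjacent F u v → place u ≡ parent (place v) ⊎ place v ≡ parent (place u)
  place-edge {u} {v} e = edge (trans (sym (proj₂ F⊆G u v)) e)

  place-distinct : ∀ {u v} → Adjacent F u v → place u ≢ place v
  place-distinct {u} e eq with refl ← place-injective eq with () ← trans (sym e) (adj-irr F u)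

  degree≤2 : ∀ v → place v ≢ 0 → degree F v ≤ 2
  degree≤2 v v≢0 = degree≤ v (parent (place v) ∷ suc (place v) ∷ []) λ u e →
    [ (λ v≡pu → there (here (legs v≢0 v≡pu))) , here ]′ (place-edge e)

  degree≤3 : ∀ v → degree F v ≤ 3
  degree≤3 v with place v ℕ.≟ 0
  ... | no  v≢0 = ℕ.≤-trans (degree≤2 v v≢0) (ℕ.n≤1+n 2)
  ... | yes v≡0 = ℕ.≤-trans (degree≤ v feet covers) at-most-3
    where
    covers : ∀ u → Adjacent F v u → place u ∈ feet
    covers u e with place-edge e
    ... | inj₁ v≡pu =
      children-of-0 (λ u≡0 → place-distinct e (trans v≡0 (sym u≡0))) (trans (sym v≡0) v≡pu)
    -- The bound `parent≤` forces `parent 0` to be `0`, so `u` would be placed where `v` is.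
    ... | inj₂ u≡pv = contradiction
      (trans v≡0 (sym (trans u≡pv (trans (cong parent v≡0) (ℕ.n≤0⇒n≡0 (parent≤ 0))))))
                        (place-distinct e)

  -- The vertex of F placed furthest from 0 can only be adjacent to its parent.
  last-degree≤1 : 0 < order F → ∃[ v ] degree F v ≤ 1
  last-degree≤1 0<n with argmax 0<n place
  ... | v , max = v , degree≤ v (parent (place v) ∷ []) covers
    where
    covers : ∀ u → Adjacent F v u → place u ∈ parent (place v) ∷ []
    covers u e with place-edge e
    ... | inj₂ u≡pv = here u≡pv
    ... | inj₁ v≡pu = contradiction
      (ℕ.≤-antisym (ℕ.≤-trans (ℕ.≤-reflexive v≡pu) (parent≤ _)) (max u)) (place-distinct e)

  -- The vertex placed last has degree at most 1, no degree exceeds 3, and degree 3 is possible only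
  -- at place `0`, which at most one vertex occupies.
  ¬unspidery : ¬ Unspidery F
  ¬unspidery (inj₁ (0<n , deg)) with last-degree≤1 0<n
  ... | v , deg≤1 = contradiction (deg v) (ℕ.<⇒≱ (s≤s deg≤1))
  ¬unspidery (inj₂ (inj₁ (v , deg))) = contradiction deg (ℕ.<⇒≱ (s≤s (degree≤3 v)))
  ¬unspidery (inj₂ (inj₂ (u , v , u≢v , deg-u , deg-v))) =
    u≢v (place-injective (trans (at-0 u deg-u) (sym (at-0 v deg-v))))
    where
    at-0 : ∀ w → 3 ≤ degree F w → place w ≡ 0
    at-0 w deg with place w ℕ.≟ 0
    ... | yes w≡0 = w≡0
    ... | no  w≢0 = contradiction deg (ℕ.<⇒≱ (s≤s (degree≤2 w w≢0)))

-- Connectivity and the class 𝒮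

Reachable-sym : ∀ G {u v} → Reachable G u v → Reachable G v u
Reachable-sym G = reverse (λ {i} {j} e → trans (adj-sym G j i) e)

Connected : Graph → Set
Connected G = ∀ u v → Reachable G u v

-- A sufficient test for connectivity that depends on the numbering: descending to ever smaller
-- neighbours ends at vertex `0`. Unlike `Connected`, it is decided by bounded quantifiers.
HasParents : Graph → Set
HasParents G = ∀ (v : Vertex G) → toℕ v ≡ 0 ⊎ ∃[ u ] toℕ u < toℕ v × Adjacent G v u

hasParents? : ∀ G → Dec (HasParents G)
hasParents? G = all? λ v → (toℕ v ℕ.≟ 0) ⊎-dec any? λ u → (toℕ u ℕ.<? toℕ v) ×-dec Adjacent? G v u

hasParents⇒connected : ∀ G → HasParents G → Connected G
hasParents⇒connected G parents u v with to-root _ u ℕ.≤-refl | to-root _ v ℕ.≤-refl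
  where
  to-root : ∀ k v → toℕ v ≤ k → ∃[ r ] toℕ r ≡ 0 × Reachable G v r
  to-root k v v≤k with parents v | k
  ... | inj₁ v≡0           | _     = v , v≡0 , ε
  ... | inj₂ (u , u<v , _) | zero  = contradiction (ℕ.<-≤-trans u<v v≤k) λ ()
  ... | inj₂ (u , u<v , e) | suc k with to-root k u (ℕ.≤-pred (ℕ.<-≤-trans u<v v≤k))
  ... | r , r≡0 , path = r , r≡0 , e ◅ path
... | r , r≡0 , u→r | s , s≡0 , v→s with refl ← toℕ-injective (trans r≡0 (sym s≡0)) =
  u→r ◅◅ Reachable-sym G v→s

Reachable-map : ∀ {F G} ((f , _) : F ⊆ᵢ G) {u v} → Reachable F u v →
                Reachable G (Injection.to f u) (Injection.to f v)
Reachable-map {F} {G} (f , f-adj) = gmap (Injection.to f) (λ {i} {j} e → trans (sym (f-adj i j)) e)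

-- Every vertex of `F` is reachable from `v`, so its image lies in the component and can be pulled
-- back to `D`.
component-absorbs : ∀ {F G D} → Connected F → ((f , _) : F ⊆ᵢ G) (v : Vertex F) →
                    IsComponentAt D G (Injection.to f v) → F ⊆ᵢ D
component-absorbs {F} {G} {D} connected F⊆G@(f , f-adj) v ((g , g-adj) , component) =
  mk↣ back-injective , λ i j →
    trans (f-adj i j) (trans (sym (cong₂ (adj G) (eq i) (eq j))) (sym (g-adj _ _)))
  where
  back : Vertex F → Vertex D
  back u = proj₁ (Equivalence.from (component _) (Reachable-map {F} {G} F⊆G (connected v u)))
  eq : ∀ u → Injection.to g (back u) ≡ Injection.to f u
  eq u = proj₂ (Equivalence.from (component _) (Reachable-map {F} {G} F⊆G (connected v u)))
  back-injective : ∀ {i j} → back i ≡ back j → i ≡ j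
  back-injective {i} {j} bi≡bj =
    Injection.injective f (trans (sym (eq i)) (trans (cong (Injection.to g) bi≡bj) (eq j)))

Obstruction : Graph → Set
Obstruction F = 0 < order F × HasParents F × Unspidery F

obstruction? : ∀ F → Dec (Obstruction F)
obstruction? F = (0 ℕ.<? order F) ×-dec hasParents? F ×-dec unspidery? F

obstruction⇒∉𝒮 : ∀ {F G} → Obstruction F → F ⊆ᵢ G → ¬ 𝒮 G
obstruction⇒∉𝒮 {F} {G} (0<n , parents , unspidery) F⊆G G∈𝒮 = go (fromℕ< 0<n)
  where
  go : Vertex F → ⊥
  go v with G∈𝒮 (Injection.to (proj₁ F⊆G) v)
  ... | D , component , shape
    with component-absorbs {F} {G} {D} (hasParents⇒connected F parents) F⊆G v component | shape
  ... | F⊆D | inj₁ (h , i , j , _ , _ , _ , D≅S) =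
    ¬unspidery {F} {S[ h , i , j ]} (claw-spider h i j)
      (⊆ᵢ-trans {F} {D} {S[ h , i , j ]} F⊆D (≅⇒⊆ᵢ {D} {S[ h , i , j ]} D≅S)) unspidery
  ... | F⊆D | inj₂ (t , _ , D≅P) =
    ¬unspidery {F} {P t} (path-spider t) (⊆ᵢ-trans {F} {D} {P t} F⊆D (≅⇒⊆ᵢ {D} {P t} D≅P)) unspidery

ClosedImage : ∀ F G → F ⊆ᵢ G → Set
ClosedImage F G (f , _) = ∀ v w → Adjacent G (Injection.to f v) w → ∃[ u ] Injection.to f u ≡ w

-- A walk in `G` that starts in a closed image never leaves it, so it lifts to `F`.
component-image : ∀ {D F G} (F⊆G : F ⊆ᵢ G) → ClosedImage F G F⊆G → ∀ v →
                  IsComponentAt D F v → IsComponentAt D G (Injection.to (proj₁ F⊆G) v)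
component-image {D} {F} {G} F⊆G@(f , f-adj) closed v (D⊆F@(g , _) , component) =
  ⊆ᵢ-trans {D} {F} {G} D⊆F F⊆G , λ u → mk⇔
    (λ { (i , refl) → Reachable-map {F} {G} F⊆G (Equivalence.to (component _) (i , refl)) })
    (in-image ε)
  where
  -- The first argument accumulates the part of the walk already lifted to `F`; the second is what
  -- remains in `G`.
  in-image : ∀ {u v′} → Reachable F v v′ → Reachable G (Injection.to f v′) u →
             ∃[ i ] Injection.to f (Injection.to g i) ≡ u
  in-image v→v′ ε with Equivalence.from (component _) v→v′
  ... | i , gi≡v′ = i , cong (Injection.to f) gi≡v′
  in-image {v′ = v′} v→v′ (e ◅ path) with closed v′ _ e
  ... | w , refl = in-image (v→v′ ◅◅ (trans (f-adj v′ w) e ◅ ε)) path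

-- Membership in `𝒮` is a condition at each vertex, so it may be checked in any closed piece around
-- that vertex. Isomorphic copies and disjoint unions are both instances.
𝒮-local : ∀ {G} →
          (∀ w → ∃[ F ] Σ (F ⊆ᵢ G) λ F⊆G →
            𝒮 F × ClosedImage F G F⊆G × ∃[ v ] Injection.to (proj₁ F⊆G) v ≡ w) →
          𝒮 G
𝒮-local {G} local w with local w
... | F , F⊆G , F∈𝒮 , closed , v , refl with F∈𝒮 v
... | D , component , shape = D , component-image {D} {F} {G} F⊆G closed v component , shape

𝒮-≅ : ∀ {F G} → F ≅ G → 𝒮 F → 𝒮 G
𝒮-≅ {F} {G} F≅G@(f , _) F∈𝒮 = 𝒮-local {G} λ w →
  F , ≅⇒⊆ᵢ {F} {G} F≅G , F∈𝒮 , (λ _ w _ → preimage w) , preimage w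
  where
  preimage : ∀ w → ∃[ u ] Inverse.to f u ≡ w
  preimage w = Inverse.from f w , Inverse.strictlyInverseˡ f w

⊕-left : ∀ G H → G ⊆ᵢ G ⊕ H
⊕-left G H = mk↣ (↑ˡ-injective (order H) _ _) , λ i j →
  sym (cong₂ (Union.adj⊎ G H) (splitAt-↑ˡ (order G) i (order H)) (splitAt-↑ˡ (order G) j (order H)))

⊕-right : ∀ G H → H ⊆ᵢ G ⊕ H
⊕-right G H = mk↣ (↑ʳ-injective (order G) _ _) , λ i j →
  sym (cong₂ (Union.adj⊎ G H) (splitAt-↑ʳ (order G) (order H) i) (splitAt-↑ʳ (order G) (order H) j))

⊕-left-closed : ∀ G H → ClosedImage G (G ⊕ H) (⊕-left G H)
⊕-left-closed G H v w e with splitAt (order G) w in eq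
... | inj₁ u = u , splitAt⁻¹-↑ˡ eq
... | inj₂ _ rewrite splitAt-↑ˡ (order G) v (order H) with () ← e

⊕-right-closed : ∀ G H → ClosedImage H (G ⊕ H) (⊕-right G H)
⊕-right-closed G H v w e with splitAt (order G) w in eq
... | inj₂ u = u , splitAt⁻¹-↑ʳ eq
... | inj₁ _ rewrite splitAt-↑ʳ (order G) (order H) v with () ← e

𝒮-⊕ : ∀ {G H} → 𝒮 G → 𝒮 H → 𝒮 (G ⊕ H)
𝒮-⊕ {G} {H} G∈𝒮 H∈𝒮 = 𝒮-local {G ⊕ H} local
  where
  local : ∀ w → ∃[ F ] Σ (F ⊆ᵢ G ⊕ H) λ F⊆G →
            𝒮 F × ClosedImage F (G ⊕ H) F⊆G × ∃[ v ] Injection.to (proj₁ F⊆G) v ≡ w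
  local w with splitAt (order G) w in eq
  ... | inj₁ v = G , ⊕-left G H , G∈𝒮 , ⊕-left-closed G H , v , splitAt⁻¹-↑ˡ eq
  ... | inj₂ v = H , ⊕-right G H , H∈𝒮 , ⊕-right-closed G H , v , splitAt⁻¹-↑ʳ eq

𝒮-· : ∀ {G} r → 𝒮 G → 𝒮 (r · G)
𝒮-· zero        G∈𝒮 ()
𝒮-· {G} (suc r) G∈𝒮 = 𝒮-⊕ {G} {r · G} G∈𝒮 (𝒮-· {G} r G∈𝒮)

connected-𝒮 : ∀ {G} → Connected G → IsSubdividedClaw G ⊎ IsPath G → 𝒮 G
connected-𝒮 {G} connected shape v =
  G , (⊆ᵢ-refl {G} , λ u → mk⇔ (λ _ → connected v u) (λ _ → u , refl)) , shape

-- For a numeral `t` the implicit argument evaluates to the unit type and is filled in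
-- automatically.
path∈𝒮 : ∀ t → 1 ≤ t → {True (hasParents? (P t))} → 𝒮 (P t)
path∈𝒮 t 1≤t {parents} =
  connected-𝒮 {P t} (hasParents⇒connected (P t) (toWitness parents)) (inj₂ (t , 1≤t , ≅-refl {P t}))

claw∈𝒮 : ∀ h i j → 1 ≤ h → h ≤ i → i ≤ j → {True (hasParents? S[ h , i , j ])} → 𝒮 S[ h , i , j ]
claw∈𝒮 h i j 1≤h h≤i i≤j {parents} =
  connected-𝒮 {S[ h , i , j ]} (hasParents⇒connected S[ h , i , j ] (toWitness parents))
    (inj₁ (h , i , j , 1≤h , h≤i , i≤j , ≅-refl {S[ h , i , j ]}))

-- Complete and edgeless graphs

pair-⊆ᵢ : ∀ {G b} i j → i ≢ j → adj G i j ≡ b → ⟦ (b ∷ []) ∷ [] ∷ [] ⟧ ⊆ᵢ G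
pair-⊆ᵢ {G} {b} i j i≢j eq = mk↣ f-inj , f-adj
  where
  f : Fin 2 → Vertex G
  f zero       = i
  f (suc zero) = j
  f-inj : ∀ {u v} → f u ≡ f v → u ≡ v
  f-inj {zero}     {zero}     _  = refl
  f-inj {zero}     {suc zero} eq = contradiction eq i≢j
  f-inj {suc zero} {zero}     eq = contradiction (sym eq) i≢j
  f-inj {suc zero} {suc zero} _  = refl
  f-adj : ∀ u v → adj ⟦ (b ∷ []) ∷ [] ∷ [] ⟧ u v ≡ adj G (f u) (f v)
  f-adj zero       zero       = sym (adj-irr G i)
  f-adj zero       (suc zero) = sym eq
  f-adj (suc zero) zero       = trans (sym eq) (adj-sym G i j)
  f-adj (suc zero) (suc zero) = sym (adj-irr G j)

2P₁-free⇒complete : ∀ {G} → ¬ (2 · P 1 ⊆ᵢ G) → G ≅ K (order G)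
2P₁-free⇒complete {G} free = ↔-id _ , same-adj
  where
  same-adj : ∀ i j → adj G i j ≡ adj (K (order G)) i j
  same-adj i j with i ≟ j
  ... | yes refl = adj-irr G i
  ... | no  i≢j  = ¬-not λ non-adjacent → free
    (⊆ᵢ-trans {2 · P 1} {⟦ (false ∷ []) ∷ [] ∷ [] ⟧} {G}
      (toWitness {a? = 2 · P 1 ⊆ᵢ? ⟦ (false ∷ []) ∷ [] ∷ [] ⟧} _)
      (pair-⊆ᵢ {G} i j i≢j non-adjacent))

complete⇒2P₁-free : ∀ {s G} → G ≅ K s → ¬ (2 · P 1 ⊆ᵢ G)
complete⇒2P₁-free {s} {G} G≅K 2P₁⊆G = contradiction (trans (f-adj zero (suc zero)) K-adj) λ ()
  where
  2P₁⊆K = ⊆ᵢ-trans {2 · P 1} {G} {K s} 2P₁⊆G (≅⇒⊆ᵢ {G} {K s} G≅K)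
  f = Injection.to (proj₁ 2P₁⊆K)
  f-adj = proj₂ 2P₁⊆K
  K-adj : adj (K s) (f zero) (f (suc zero)) ≡ true
  K-adj with f zero ≟ f (suc zero)
  ... | yes eq = contradiction (Injection.injective (proj₁ 2P₁⊆K) eq) λ ()
  ... | no  _  = refl

order-tP₁ : ∀ t → order (t · P 1) ≡ t
order-tP₁ zero    = refl
order-tP₁ (suc t) = cong suc (order-tP₁ t)

edgeless-tP₁ : ∀ t i j → adj (t · P 1) i j ≡ false
edgeless-tP₁ (suc t) i j with splitAt 1 i | splitAt 1 j
... | inj₁ zero | inj₁ zero = refl
... | inj₁ _    | inj₂ _    = refl
... | inj₂ _    | inj₁ _    = refl
... | inj₂ u    | inj₂ v    = edgeless-tP₁ t u v

P₂-free⇒edgeless : ∀ {G} → ¬ (P 2 ⊆ᵢ G) → G ≅ order G · P 1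
P₂-free⇒edgeless {G} free =
  -- The order of `t · P 1` equals `t` only propositionally, so the identity has to be a `cast`.
  mk↔ₛ′ (cast (sym eq)) (cast eq) (cast-involutive (sym eq) eq) (cast-involutive eq (sym eq)) , same-adj
  where
  eq = order-tP₁ (order G)
  same-adj : ∀ i j → adj G i j ≡ adj (order G · P 1) (cast (sym eq) i) (cast (sym eq) j)
  same-adj i j with i ≟ j
  ... | yes refl = trans (adj-irr G i) (sym (edgeless-tP₁ (order G) _ _))
  ... | no  i≢j  = trans (¬-not λ adjacent → free
    (⊆ᵢ-trans {P 2} {⟦ (true ∷ []) ∷ [] ∷ [] ⟧} {G}
      (toWitness {a? = P 2 ⊆ᵢ? ⟦ (true ∷ []) ∷ [] ∷ [] ⟧} _)
      (pair-⊆ᵢ {G} i j i≢j adjacent))) (sym (edgeless-tP₁ (order G) _ _))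

edgeless⇒P₂-free : ∀ {t G} → G ≅ t · P 1 → ¬ (P 2 ⊆ᵢ G)
edgeless⇒P₂-free {t} {G} G≅tP₁ P₂⊆G =
  contradiction (trans (proj₂ P₂⊆tP₁ zero (suc zero)) (edgeless-tP₁ t _ _)) λ ()
  where
  P₂⊆tP₁ = ⊆ᵢ-trans {P 2} {G} {t · P 1} P₂⊆G (≅⇒⊆ᵢ {G} {t · P 1} G≅tP₁)

-- The cases of (A), (C) and (D) as rules

-- A syntax for the hypotheses of the cases, so that they can be decided on codes, complemented and
-- transported along isomorphisms uniformly. The condition `avoids` expresses the infinite families
-- of complete and of edgeless graphs by one forbidden graph.
data Condition : Set where
  any             : Condition
  within contains : List Graph → Condition
  avoids is       : Graph → Condition

Holds : Condition → Graph → Set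
Holds any           G = ⊤
Holds (within Xs)   G = G ⊆ᵢ-some Xs
Holds (contains Xs) G = G ⊇ᵢ-some Xs
Holds (avoids X)    G = ¬ (X ⊆ᵢ G)
Holds (is X)        G = G ≅ X

within? : ∀ {n} (G : Code n) X → Dec (⟦ G ⟧ ⊆ᵢ X)
within? G X = map′
  (λ p → ⊆ᵢ-trans {⟦ G ⟧} {⟦ code X ⟧} {X} p (≅⇒⊆ᵢ {⟦ code X ⟧} {X} (code-correct X)))
  (λ p → ⊆ᵢ-trans {⟦ G ⟧} {X} {⟦ code X ⟧} p (≅⇒⊇ᵢ {⟦ code X ⟧} {X} (code-correct X)))
  (G ⊆ᶜ? code X)

contains? : ∀ {n} (G : Code n) X → Dec (⟦ G ⟧ ⊇ᵢ X)
contains? G X = map′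
  (⊆ᵢ-trans {X} {⟦ code X ⟧} {⟦ G ⟧} (≅⇒⊇ᵢ {⟦ code X ⟧} {X} (code-correct X)))
  (⊆ᵢ-trans {⟦ code X ⟧} {X} {⟦ G ⟧} (≅⇒⊆ᵢ {⟦ code X ⟧} {X} (code-correct X)))
  (code X ⊆ᶜ? G)

holds? : ∀ c {n} (G : Code n) → Dec (Holds c ⟦ G ⟧)
holds? any           G = yes tt
holds? (within Xs)   G = Any.any? (within? G) Xs
holds? (contains Xs) G = Any.any? (contains? G) Xs
holds? (avoids X)    G = ¬? (contains? G X)
holds? (is X)        G = map′ (λ (p , q) → ⊆ᵢ-antisym {⟦ G ⟧} {X} p q)
                              (λ G≅X → ≅⇒⊆ᵢ {⟦ G ⟧} {X} G≅X , ≅⇒⊇ᵢ {⟦ G ⟧} {X} G≅X)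
                              (within? G X ×-dec contains? G X)

Holds-≅ : ∀ c {F G} → F ≅ G → Holds c F → Holds c G
Holds-≅ any           F≅G = id
Holds-≅ (within Xs)   {F} {G} F≅G = Any.map λ {X} → ⊆ᵢ-trans {G} {F} {X} (≅⇒⊇ᵢ {F} {G} F≅G)
Holds-≅ (contains Xs) {F} {G} F≅G = Any.map λ {X} p → ⊆ᵢ-trans {X} {F} {G} p (≅⇒⊆ᵢ {F} {G} F≅G)
Holds-≅ (avoids X)    {F} {G} F≅G = _∘ λ p → ⊆ᵢ-trans {X} {G} {F} p (≅⇒⊇ᵢ {F} {G} F≅G)
Holds-≅ (is X)        {F} {G} F≅G = ≅-trans {G} {F} {X} (≅-sym {F} {G} F≅G)

coᶜ : Condition → Condition
coᶜ any           = any
coᶜ (within Xs)   = within (map co Xs)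
coᶜ (contains Xs) = contains (map co Xs)
coᶜ (avoids X)    = avoids (co X)
coᶜ (is X)        = is (co X)

Holds-coᶜ : ∀ c {G} → Holds (coᶜ c) G → Holds c (co G)
Holds-coᶜ any           _ = tt
Holds-coᶜ (within Xs)   {G} = Any.map (λ {X} p →
  ⊆ᵢ-trans {co G} {co (co X)} {X} (co-mono {G} {co X} p) (≅⇒⊆ᵢ {co (co X)} {X} (co-involutive X))) ∘ Any.map⁻
Holds-coᶜ (contains Xs) {G} = Any.map (λ {X} p →
  ⊆ᵢ-trans {X} {co (co X)} {co G} (≅⇒⊇ᵢ {co (co X)} {X} (co-involutive X)) (co-mono {co X} {G} p)) ∘ Any.map⁻
Holds-coᶜ (avoids X)    {G} free X⊆coG = free
  (⊆ᵢ-trans {co X} {co (co G)} {G} (co-mono {X} {co G} X⊆coG) (≅⇒⊆ᵢ {co (co G)} {G} (co-involutive G)))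
Holds-coᶜ (is X)        {G} G≅coX =
  ≅-trans {co G} {co (co X)} {X} (co-cong {G} {co X} G≅coX) (co-involutive X)

Rule : Set
Rule = Condition × Condition

Applies : Graph → Graph → Rule → Set
Applies F₁ F₂ (c , d) = Holds c F₁ × Holds d F₂

SomeApplies : List Rule → Graph → Graph → Set
SomeApplies rs F₁ F₂ = Any (Applies F₁ F₂) rs

only : ∀ {P : Graph → Set} {X} → Any P (X ∷ []) → P X
only (here p) = p

-- The third rule is the Ramsey case: F₁ is complete and F₂ is edgeless.
boundedRules : List Rule
boundedRules =
    (within (P 4 ∷ []) , any)
  ∷ (any , within (P 4 ∷ []))
  ∷ (avoids (2 · P 1) , avoids (P 2))
  ∷ (within (paw ∷ []) , within (K[ 1 , 3 ] ⊕ 3 · P 1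
                                ∷ K[ 1 , 3 ] ⊕ P 2
                                ∷ P 1 ⊕ P 2 ⊕ P 3
                                ∷ P 1 ⊕ P 5
                                ∷ P 1 ⊕ S[ 1 , 1 , 2 ]
                                ∷ P 2 ⊕ P 4
                                ∷ P 6
                                ∷ S[ 1 , 1 , 3 ]
                                ∷ S[ 1 , 2 , 2 ]
                                ∷ []))
  ∷ (within (diamond ∷ []) , within (P 1 ⊕ 2 · P 2 ∷ 3 · P 1 ⊕ P 2 ∷ P 2 ⊕ P 3 ∷ []))
  ∷ (within (gem ∷ []) , within (P 1 ⊕ P 4 ∷ P 5 ∷ []))
  ∷ (within (K 3 ⊕ P 1 ∷ []) , within (K[ 1 , 3 ] ∷ []))
  ∷ (within (co (2 · P 1 ⊕ P 3) ∷ []) , within (2 · P 1 ⊕ P 3 ∷ []))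
  ∷ []

bounded⇒ : ∀ {F₁ F₂} → BoundedCase F₁ F₂ → SomeApplies boundedRules F₁ F₂
bounded⇒ (P₄-case (inj₁ p))      = here (here p , tt)
bounded⇒ (P₄-case (inj₂ p))      = there (here (tt , here p))
bounded⇒ {F₁} {F₂} (Ramsey-case (s , t , _ , _ , p , q)) = there (there (here
  (complete⇒2P₁-free {s} {F₁} p , edgeless⇒P₂-free {t} {F₂} q)))
bounded⇒ (paw-case p q)          = there (there (there (here (here p , q))))
bounded⇒ (diamond-case p q)      = there (there (there (there (here (here p , q)))))
bounded⇒ (gem-case p q)          = there (there (there (there (there (here (here p , q))))))
bounded⇒ (K₃+P₁-case p q)        = there (there (there (there (there (there (here (here p , here q)))))))
bounded⇒ (2P₁+P₃-case p q)       = there (there (there (there (there (there (there (here (here p , here q))))))))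

empty-⊆ᵢ : ∀ {F} G → order F ≡ 0 → F ⊆ᵢ G
empty-⊆ᵢ {F} G n≡0 = mk↣ {to = λ i → absurd i} (λ {i} → absurd i) , λ i → absurd i
  where
  absurd : ∀ {a} {A : Set a} → Fin (order F) → A
  absurd i with () ← subst Fin n≡0 i

bounded⇐ : ∀ {F₁ F₂} → SomeApplies boundedRules F₁ F₂ → BoundedCase F₁ F₂
bounded⇐ (here (p , _))         = P₄-case (inj₁ (only p))
bounded⇐ (there (here (_ , p))) = P₄-case (inj₂ (only p))
-- The Ramsey case asks for `1 ≤ s` and `1 ≤ t`; a graph without vertices falls under the `P 4` case
-- instead.
bounded⇐ {F₁} {F₂} (there (there (here (p , q)))) with order F₁ ℕ.≟ 0 | order F₂ ℕ.≟ 0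
... | yes s≡0 | _       = P₄-case (inj₁ (empty-⊆ᵢ {F₁} (P 4) s≡0))
... | no _    | yes t≡0 = P₄-case (inj₂ (empty-⊆ᵢ {F₂} (P 4) t≡0))
... | no s≢0  | no t≢0  = Ramsey-case (order F₁ , order F₂ , ℕ.n≢0⇒n>0 s≢0 , ℕ.n≢0⇒n>0 t≢0
  , 2P₁-free⇒complete {F₁} p , P₂-free⇒edgeless {F₂} q)
bounded⇐ (there (there (there (here (p , q))))) = paw-case (only p) q
bounded⇐ (there (there (there (there (here (p , q)))))) = diamond-case (only p) q
bounded⇐ (there (there (there (there (there (here (p , q))))))) = gem-case (only p) q
bounded⇐ (there (there (there (there (there (there (here (p , q)))))))) = K₃+P₁-case (only p) (only q)
bounded⇐ (there (there (there (there (there (there (there (here (p , q))))))))) = 2P₁+P₃-case (only p) (only q)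

unboundedRules : List Rule
unboundedRules =
    (contains (diamond ∷ []) , contains (K[ 1 , 3 ] ∷ 5 · P 1 ∷ P 2 ⊕ P 4 ∷ []))
  ∷ (contains (K 4 ∷ []) , contains (P 1 ⊕ P 4 ∷ 3 · P 1 ⊕ P 2 ∷ 2 · P 2 ∷ []))
  ∷ (contains (K 3 ⊕ P 1 ∷ []) , contains (4 · P 1 ∷ 2 · P 2 ∷ []))
  ∷ (contains (K 3 ∷ []) , contains (2 · P 1 ⊕ 2 · P 2
                                    ∷ 2 · P 1 ⊕ P 4
                                    ∷ 4 · P 1 ⊕ P 2
                                    ∷ 3 · P 2
                                    ∷ 2 · P 3
                                    ∷ []))
  ∷ (contains (gem ∷ []) , contains (P 1 ⊕ 2 · P 2 ∷ []))
  ∷ []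

unbounded⇒ : ∀ {F₁ F₂} → UnboundedCase F₁ F₂ →
             (¬ 𝒮 F₁ × ¬ 𝒮 F₂) ⊎ (¬ co-𝒮 F₁ × ¬ co-𝒮 F₂) ⊎ SomeApplies unboundedRules F₁ F₂
unbounded⇒ (𝒮-case p q)       = inj₁ (p , q)
unbounded⇒ (co-𝒮-case p q)    = inj₂ (inj₁ (p , q))
unbounded⇒ (diamond-case p q) = inj₂ (inj₂ (here (here p , q)))
unbounded⇒ (K₄-case p q)      = inj₂ (inj₂ (there (here (here p , q))))
unbounded⇒ (K₃+P₁-case p q)   = inj₂ (inj₂ (there (there (here (here p , q)))))
unbounded⇒ (K₃-case p q)      = inj₂ (inj₂ (there (there (there (here (here p , q))))))
unbounded⇒ (gem-case p q)     = inj₂ (inj₂ (there (there (there (there (here (here p , here q)))))))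

unbounded⇐ : ∀ {F₁ F₂} → SomeApplies unboundedRules F₁ F₂ → UnboundedCase F₁ F₂
unbounded⇐ (here (p , q))                                 = diamond-case (only p) q
unbounded⇐ (there (here (p , q)))                         = K₄-case (only p) q
unbounded⇐ (there (there (here (p , q))))                 = K₃+P₁-case (only p) q
unbounded⇐ (there (there (there (here (p , q)))))         = K₃-case (only p) q
unbounded⇐ (there (there (there (there (here (p , q)))))) = gem-case (only p) (only q)

atomUnboundedRules : List (List Graph × List Graph)
atomUnboundedRules =
    (diamond ∷ [] , P 1 ⊕ P 6 ∷ [])
  ∷ (2 · P 1 ⊕ P 2 ∷ [] , co (P 6) ∷ [])
  ∷ (gem ∷ [] , P 6 ∷ [])
  ∷ (P 1 ⊕ 2 · P 2 ∷ P 6 ∷ [] , co (P 1 ⊕ 2 · P 2) ∷ co (P 2 ⊕ P 3) ∷ [])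
  ∷ (2 · P 2 ∷ [] , co (P 2 ⊕ P 4) ∷ co (3 · P 2) ∷ co (P 5) ∷ [])
  ∷ []

AtomRuleApplies : Graph → Graph → List Graph × List Graph → Set
AtomRuleApplies F₁ F₂ (Xs , Ys) = F₁ ⊇ᵢ-some Xs × F₂ ⊇ᵢ-some Ys

atomUnbounded⇒ : ∀ {F₁ F₂} → AtomUnboundedCase F₁ F₂ → Any (AtomRuleApplies F₁ F₂) atomUnboundedRules
atomUnbounded⇒ (diamond-case p q)    = here (here p , here q)
atomUnbounded⇒ (2P₁+P₂-case p q)     = there (here (here p , here q))
atomUnbounded⇒ (gem-case p q)        = there (there (here (here p , here q)))
atomUnbounded⇒ (P₁+2P₂-P₆-case p q)  = there (there (there (here (p , q))))
atomUnbounded⇒ (2P₂-case p q)        = there (there (there (there (here (here p , q)))))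

atomUnbounded⇐ : ∀ {F₁ F₂} → Any (AtomRuleApplies F₁ F₂) atomUnboundedRules → AtomUnboundedCase F₁ F₂
atomUnbounded⇐ (here (p , q))                                 = diamond-case (only p) (only q)
atomUnbounded⇐ (there (here (p , q)))                         = 2P₁+P₂-case (only p) (only q)
atomUnbounded⇐ (there (there (here (p , q))))                 = gem-case (only p) (only q)
atomUnbounded⇐ (there (there (there (here (p , q)))))         = P₁+2P₂-P₆-case p q
atomUnbounded⇐ (there (there (there (there (here (p , q)))))) = 2P₂-case (only p) q

-- The hypotheses of the theorem and the pairs of (E) are written as rules too, so that a single
-- finite check can assert that every pair is covered.
subclassRules exceptionRules openRules : List Rule
subclassRules =
    (within (P 6 ∷ []) , within (co (2 · P 2) ∷ []))
  ∷ (within (2 · P 2 ∷ []) , within (co (P 2 ⊕ P 3) ∷ []))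
  ∷ []
exceptionRules =
    (is paw , any)
  ∷ (is (P 1 ⊕ P 3) , any)
  ∷ (is (3 · P 1) , is (co S[ 1 , 2 , 3 ]))
  ∷ []
openRules = map (λ (A , B) → is A , is B) openPairs

data Settled (H₁ H₂ : Graph) : Set where
  by-A        : ConditionA H₁ H₂ → Settled H₁ H₂
  by-B        : ConditionB H₁ H₂ → Settled H₁ H₂
  by-C        : ConditionC H₁ H₂ → Settled H₁ H₂
  by-D        : ConditionD H₁ H₂ → Settled H₁ H₂
  exceptional : SomeApplies exceptionRules H₁ H₂ ⊎ SomeApplies exceptionRules H₂ H₁ → Settled H₁ H₂
  open-pair   : SomeApplies openRules H₁ H₂ ⊎ SomeApplies openRules H₂ H₁ → Settled H₁ H₂

swap-∼ : ∀ {H₁ H₂} → (H₁ , H₂) ∼ (H₂ , H₁)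
swap-∼ {H₁} {H₂} = same (inj₂ (≅-refl {H₁} , ≅-refl {H₂})) ◅ ε

Settled-sym : ∀ {H₁ H₂} → Settled H₁ H₂ → Settled H₂ H₁
Settled-sym {H₁} {H₂} (by-A (F₁ , F₂ , p∼ , case)) = by-A (F₁ , F₂ , swap-∼ {H₂} {H₁} ◅◅ p∼ , case)
Settled-sym {H₁} {H₂} (by-B (inj₁ B)) = by-B (inj₁ λ {G} free → B {G} (Product.swap free))
Settled-sym {H₁} {H₂} (by-B (inj₂ B)) = by-B (inj₂ λ {G} free → B {G} (Product.swap free))
Settled-sym {H₁} {H₂} (by-C (F₁ , F₂ , p∼ , case)) = by-C (F₁ , F₂ , swap-∼ {H₂} {H₁} ◅◅ p∼ , case)
Settled-sym (by-D (F₁ , F₂ , Free⊆ , case)) =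
  by-D (F₁ , F₂ , (λ {G} free → Product.swap (Free⊆ {G} free)) , case)
Settled-sym (exceptional e) = exceptional (Sum.swap e)
Settled-sym (open-pair e) = open-pair (Sum.swap e)

-- Rules for (H₁ , H₂) are turned into rules for (H₁ , co H₂), as these two graphs may both lie in 𝒮.

straight crossed co-straight co-crossed : Rule → Rule
straight    (c , d) = c , coᶜ d
crossed     (c , d) = d , coᶜ c
co-straight (c , d) = coᶜ c , d
co-crossed  (c , d) = coᶜ d , c

-- Two ways account for the order of the pair. Four ways also account for complementing both graphs,
-- which (A) and (C) allow but the other outcomes do not.
twoWays fourWays : List Rule → List Rule
twoWays  rs = map straight rs ++ map crossed rs
fourWays rs = twoWays rs ++ map co-straight rs ++ map co-crossed rs

contain-both : List Graph × List Graph → Rule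
contain-both (Xs , Ys) = contains Xs , contains Ys

pairRules : List Rule
pairRules = fourWays unboundedRules
         ++ fourWays boundedRules
         ++ twoWays exceptionRules
         ++ twoWays subclassRules
         ++ twoWays (map contain-both atomUnboundedRules)
         ++ twoWays openRules

Holds-co-co : ∀ c {G} → Holds (coᶜ c) (co G) → Holds c G
Holds-co-co c {G} = Holds-≅ c {co (co G)} {G} (co-involutive G) ∘ Holds-coᶜ c {co G}

module _ {H₁ H₂ : Graph} where

  twoWays-sound : ∀ rs → SomeApplies (twoWays rs) H₁ (co H₂) →
                  SomeApplies rs H₁ H₂ ⊎ SomeApplies rs H₂ H₁
  twoWays-sound rs = Sum.map
    (Any.map (λ {(c , d)} (p , q) → p , Holds-co-co d {H₂} q) ∘ Any.map⁻)
    (Any.map (λ {(c , d)} (p , q) → Holds-co-co c {H₂} q , p) ∘ Any.map⁻)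
    ∘ Any.++⁻ (map straight rs)

  fourWays-sound : ∀ {Case : Graph → Graph → Set} rs →
                   (∀ {F₁ F₂} → SomeApplies rs F₁ F₂ → Case F₁ F₂) →
                   SomeApplies (fourWays rs) H₁ (co H₂) →
                   ∃[ F₁ ] ∃[ F₂ ] (H₁ , H₂) ∼ (F₁ , F₂) × Case F₁ F₂
  fourWays-sound rs case applies with Any.++⁻ (twoWays rs) applies
  ... | inj₁ p with twoWays-sound rs p
  ... | inj₁ q = H₁ , H₂ , ε , case q
  ... | inj₂ q = H₂ , H₁ , swap-∼ {H₁} {H₂} , case q
  fourWays-sound rs case applies | inj₂ p with Any.++⁻ (map co-straight rs) p
  ... | inj₁ q = co H₁ , co H₂ , complement ◅ ε
               , case (Any.map (λ {(c , d)} (p , q) → Holds-coᶜ c {H₁} p , q) (Any.map⁻ q))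
  ... | inj₂ q = co H₂ , co H₁ , complement ◅ swap-∼ {co H₁} {co H₂}
               , case (Any.map (λ {(c , d)} (p , q) → q , Holds-coᶜ d {H₁} p) (Any.map⁻ q))

subclass-B : ∀ {H₁ H₂} → SomeApplies subclassRules H₁ H₂ → ConditionB H₁ H₂
subclass-B {H₁} {H₂} (here (here p , here q)) = inj₁ λ {G} (H₁⊈G , H₂⊈G) →
  H₁⊈G ∘ ⊆ᵢ-trans {H₁} {P 6} {G} p , H₂⊈G ∘ ⊆ᵢ-trans {H₂} {co (2 · P 2)} {G} q
subclass-B {H₁} {H₂} (there (here (here p , here q))) = inj₂ λ {G} (H₁⊈G , H₂⊈G) →
  H₁⊈G ∘ ⊆ᵢ-trans {H₁} {2 · P 2} {G} p , H₂⊈G ∘ ⊆ᵢ-trans {H₂} {co (P 2 ⊕ P 3)} {G} q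

atom-D : ∀ {H₁ H₂} → SomeApplies (map contain-both atomUnboundedRules) H₁ H₂ →
         ConditionD H₁ H₂
atom-D {H₁} {H₂} applies = H₁ , H₂ , id , atomUnbounded⇐ (Any.map⁻ {f = contain-both} applies)

split : ∀ {A : Set} {X Y} rs {ss} → (SomeApplies rs X Y → A) → (SomeApplies ss X Y → A) →
        SomeApplies (rs ++ ss) X Y → A
split rs f g = [ f , g ]′ ∘ Any.++⁻ rs

pairRules-sound : ∀ {H₁ H₂} → SomeApplies pairRules H₁ (co H₂) → Settled H₁ H₂
pairRules-sound {H₁} {H₂} =
  split (fourWays unboundedRules)
    (by-C ∘ fourWays-sound {H₁} {H₂} {UnboundedCase} unboundedRules unbounded⇐)
  (split (fourWays boundedRules)
    (by-A ∘ fourWays-sound {H₁} {H₂} {BoundedCase} boundedRules bounded⇐)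
  (split (twoWays exceptionRules)
    (exceptional ∘ twoWays-sound {H₁} {H₂} exceptionRules)
  (split (twoWays subclassRules)
    (both-ways subclassRules (by-B ∘ subclass-B))
  (split (twoWays (map contain-both atomUnboundedRules))
    (both-ways (map contain-both atomUnboundedRules) (by-D ∘ atom-D))
    (open-pair ∘ twoWays-sound {H₁} {H₂} openRules)))))
  where
  both-ways : ∀ rs → (∀ {F₁ F₂} → SomeApplies rs F₁ F₂ → Settled F₁ F₂) →
              SomeApplies (twoWays rs) H₁ (co H₂) → Settled H₁ H₂
  both-ways rs settle = [ settle , Settled-sym ∘ settle ]′ ∘ twoWays-sound {H₁} {H₂} rs

-- Settling finitely many descriptions of graphs by rules

data Seed : Set where
  exact above : ∃ Code → Seed

infix 4 _Describes_

_Describes_ : Seed → Graph → Set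
exact (_ , G) Describes X = ⟦ G ⟧ ≅ X
above (_ , G) Describes X = ⟦ G ⟧ ⊆ᵢ X

-- These are the conditions inherited by larger graphs. Of a graph described by `above` only an
-- induced subgraph is known, so no other condition may be used on it.
upward : Condition → Bool
upward any          = true
upward (contains _) = true
upward _            = false

HoldsOn : Seed → Condition → Set
HoldsOn (exact (_ , G)) c = Holds c ⟦ G ⟧
HoldsOn (above (_ , G)) c = T (upward c) × Holds c ⟦ G ⟧

holdsOn? : ∀ s c → Dec (HoldsOn s c)
holdsOn? (exact (_ , G)) c = holds? c G
holdsOn? (above (_ , G)) c = T? (upward c) ×-dec holds? c G

HoldsOn⇒Holds : ∀ s c {X} → s Describes X → HoldsOn s c → Holds c X
HoldsOn⇒Holds (exact (_ , G)) c             {X} G≅X = Holds-≅ c {⟦ G ⟧} {X} G≅X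
HoldsOn⇒Holds (above _)       any           _ _ = tt
HoldsOn⇒Holds (above (_ , G)) (contains Ys) {X} G⊆X (_ , p) =
  Any.map (λ {Y} Y⊆G → ⊆ᵢ-trans {Y} {⟦ G ⟧} {X} Y⊆G G⊆X) p

-- Filtering by the first condition outside the quantifier over `ts` lets the rules usable for `s`
-- be computed once and shared by all `t`.
Resolved : List Rule → List Seed → List Seed → Set
Resolved rs ss ts =
  All (λ s → All (λ t → Any (HoldsOn t ∘ proj₂) (filter (holdsOn? s ∘ proj₁) rs)) ts) ss

resolved? : ∀ rs ss ts → Dec (Resolved rs ss ts)
resolved? rs ss ts = All.all? (λ s → among (filter (holdsOn? s ∘ proj₁) rs)) ss
  where
  among : ∀ rs → Dec (All (λ t → Any (HoldsOn t ∘ proj₂) rs) ts)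
  among rs = All.all? (λ t → Any.any? (holdsOn? t ∘ proj₂) rs) ts

resolve : ∀ {rs ss ts} → Resolved rs ss ts → ∀ {X Y} → Any (_Describes X) ss → Any (_Describes Y) ts →
          SomeApplies rs X Y
resolve {rs} resolved {X} {Y} s-any t-any with find s-any | find t-any
... | s , s∈ , s-X | t , t∈ , t-Y with find (All.lookup (All.lookup resolved s∈) t∈)
... | (c , d) , r∈ , d-t with ∈-filter⁻ (holdsOn? s ∘ proj₁) {xs = rs} r∈
... | r∈′ , c-s = lose r∈′ (HoldsOn⇒Holds s c {X} s-X c-s , HoldsOn⇒Holds t d {Y} t-Y d-t)

coded : Graph → ∃ Code
coded G = order G , code G

exacts aboves : List Graph → List Seed
exacts = map (exact ∘ coded)
aboves = map (above ∘ coded)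

-- Two vertices of degree 3 at distance d.
twin-claw : ℕ → Graph
twin-claw d = graph (5 + d) λ a b →
  (b ≡ᵇ suc a) ∧ (a <ᵇ 2 + d) ∨ (a ≡ᵇ 1) ∧ (b ≡ᵇ 3 + d) ∨ (a ≡ᵇ suc d) ∧ (b ≡ᵇ 4 + d)

-- Finitely many suffice because cycles longer than `C 7`, and `twin-claw d` for `d` above 2,
-- contain `2 · P 3`, which is among the `K₃-partners`.
obstructions : List Graph
obstructions = K 3 ∷ C 4 ∷ C 5 ∷ C 6 ∷ C 7 ∷ K[ 1 , 4 ] ∷ twin-claw 1 ∷ twin-claw 2 ∷ []

abstract
  obstructions-obstruct : All Obstruction obstructions
  obstructions-obstruct = toWitness {a? = All.all? obstruction? obstructions} _

-- The right-hand sides of the K₃-case of (C).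
K₃-partners : List Graph
K₃-partners = 3 · P 2 ∷ 4 · P 1 ⊕ P 2 ∷ 2 · P 1 ⊕ 2 · P 2 ∷ 2 · P 1 ⊕ P 4 ∷ 2 · P 3 ∷ []

-- Ordered by number of vertices, from two to seven. The list ends because each one-vertex extension
-- of a listed graph contains an obstruction, a partner or a larger listed graph, as `edged-closed`
-- checks.
edged : List Graph
edged =
    P 2
  ∷ P 1 ⊕ P 2 ∷ P 3
  ∷ 2 · P 1 ⊕ P 2 ∷ 2 · P 2 ∷ P 1 ⊕ P 3 ∷ P 4 ∷ S[ 1 , 1 , 1 ]
  ∷ 3 · P 1 ⊕ P 2 ∷ P 1 ⊕ 2 · P 2 ∷ P 2 ⊕ P 3 ∷ 2 · P 1 ⊕ P 3 ∷ P 1 ⊕ P 4 ∷ P 5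
  ∷ S[ 1 , 1 , 2 ] ∷ P 1 ⊕ S[ 1 , 1 , 1 ]
  ∷ P 1 ⊕ P 2 ⊕ P 3 ∷ 3 · P 1 ⊕ P 3 ∷ P 2 ⊕ P 4 ∷ P 1 ⊕ P 5 ∷ P 6
  ∷ S[ 1 , 2 , 2 ] ∷ S[ 1 , 1 , 3 ] ∷ P 1 ⊕ S[ 1 , 1 , 2 ] ∷ P 2 ⊕ S[ 1 , 1 , 1 ] ∷ 2 · P 1 ⊕ S[ 1 , 1 , 1 ]
  ∷ P 1 ⊕ S[ 1 , 1 , 3 ] ∷ S[ 1 , 2 , 3 ] ∷ 3 · P 1 ⊕ S[ 1 , 1 , 1 ]
  ∷ []

small edgeless : List Graph
small    = K 0 ∷ P 1 ∷ 2 · P 1 ∷ P 2 ∷ P 1 ⊕ P 2 ∷ P 3 ∷ 2 · P 2 ∷ P 4 ∷ []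
edgeless = K 0 ∷ P 1 ∷ 2 · P 1 ∷ 3 · P 1 ∷ 4 · P 1 ∷ []

-- As a partner, `3 · P 2` is missing from `edged`, but it survives against graphs without
-- `3 · P 1`. The one seed `above` replaces the infinitely many larger edgeless graphs.
edgedSeeds edgelessSeeds : List Seed
edgedSeeds    = exacts (3 · P 2 ∷ edged)
edgelessSeeds = above (coded (5 · P 1)) ∷ exacts edgeless

ClosedGraphs : List Graph → List Graph → Set
ClosedGraphs Fs Gs = Closed (map coded Fs) (map coded Gs)

closedGraphs? : ∀ Fs Gs → Dec (ClosedGraphs Fs Gs)
closedGraphs? Fs Gs = closed? (map coded Fs) (map coded Gs)

abstract
  -- A new vertex joined to both ends of an edge gives `K 3`; joined to one end of each edge it
  -- gives `K[ 1 , 3 ]`; otherwise it leaves `4 · P 1`. So here `3 · P 2` cannot grow.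
  3P₂-closed : ClosedGraphs (4 · P 1 ∷ K[ 1 , 3 ] ∷ obstructions) (3 · P 2 ∷ [])
  3P₂-closed = toWitness {a? = closedGraphs? (4 · P 1 ∷ K[ 1 , 3 ] ∷ obstructions) (3 · P 2 ∷ [])} _

  small-closed : ClosedGraphs (3 · P 1 ∷ obstructions) small
  small-closed = toWitness {a? = closedGraphs? (3 · P 1 ∷ obstructions) small} _

  edgeless-closed : ClosedGraphs (P 2 ∷ 5 · P 1 ∷ []) edgeless
  edgeless-closed = toWitness {a? = closedGraphs? (P 2 ∷ 5 · P 1 ∷ []) edgeless} _

  edged×edged : Resolved pairRules edgedSeeds edgedSeeds
  edged×edged = toWitness {a? = resolved? _ _ _} _

  edged×edgeless : Resolved pairRules edgedSeeds edgelessSeeds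
  edged×edgeless = toWitness {a? = resolved? _ _ _} _

  edgeless×edged : Resolved pairRules edgelessSeeds edgedSeeds
  edgeless×edged = toWitness {a? = resolved? _ _ _} _

  -- A `3 · P 1` in `co H₂` is a `K 3` in `H₂`, so this is the `K₃-case` of (C).
  partners×3P₁ : Resolved pairRules (aboves K₃-partners) (aboves (3 · P 1 ∷ []))
  partners×3P₁ = toWitness {a? = resolved? _ _ _} _

  3P₁×partners : Resolved pairRules (aboves (3 · P 1 ∷ [])) (aboves K₃-partners)
  3P₁×partners = toWitness {a? = resolved? _ _ _} _

  -- After complementing, `4 · P 1` becomes `K 4` and `K[ 1 , 3 ]` becomes `K 3 ⊕ P 1`; against
  -- `2 · P 2` these are the `K₄-case` and the `K₃+P₁-case` of (C).
  4P₁,K₁₃×2P₂ : Resolved pairRules (aboves (4 · P 1 ∷ K[ 1 , 3 ] ∷ [])) (aboves (2 · P 2 ∷ []))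
  4P₁,K₁₃×2P₂ = toWitness {a? = resolved? _ _ _} _

  2P₂×4P₁,K₁₃ : Resolved pairRules (aboves (2 · P 2 ∷ [])) (aboves (4 · P 1 ∷ K[ 1 , 3 ] ∷ []))
  2P₂×4P₁,K₁₃ = toWitness {a? = resolved? _ _ _} _

  small-cases : All (λ H → H ⊆ᵢ P 4 ⊎ 2 · P 2 ⊆ᵢ H) small
  small-cases = toWitness {a? = All.all? (λ H → (H ⊆ᵢ? P 4) ⊎-dec (2 · P 2 ⊆ᵢ? H)) small} _

  K₃-partners-cases : All (λ F → 3 · P 2 ⊆ᵢ F ⊎ 4 · P 1 ⊆ᵢ F) K₃-partners
  K₃-partners-cases = toWitness {a? = All.all? (λ F → (3 · P 2 ⊆ᵢ? F) ⊎-dec (4 · P 1 ⊆ᵢ? F)) K₃-partners} _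

  edged-closed : ClosedGraphs (obstructions ++ K₃-partners) edged
  edged-closed = toWitness {a? = closedGraphs? (obstructions ++ K₃-partners) edged} _

-- Abstract, since otherwise with would unfold the search in an unknown graph.
abstract
  some-occurs? : ∀ Fs G → Dec (G ⊇ᵢ-some Fs)
  some-occurs? Fs G = Any.any? (_⊆ᵢ? G) Fs

  occurs? : ∀ F G → Dec (F ⊆ᵢ G)
  occurs? = _⊆ᵢ?_

-- Every pair is settled

below : ∀ {F G} → F ⊆ᵢ G → ⟦ code F ⟧ ⊆ᵢ G
below {F} {G} = ⊆ᵢ-trans {⟦ code F ⟧} {F} {G} (≅⇒⊆ᵢ {⟦ code F ⟧} {F} (code-correct F))

describes-above : ∀ Fs {G} → G ⊇ᵢ-some Fs → Any (_Describes G) (aboves Fs)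
describes-above _ {G} = Any.map⁺ ∘ Any.map (λ {F} → below {F} {G})

describes-exact : ∀ Fs Gs → ClosedGraphs Fs Gs → ∀ {G} → ¬ (G ⊇ᵢ-some Fs) → G ⊇ᵢ-some Gs →
                  Any (_Describes G) (exacts Gs)
describes-exact Fs Gs closed {G} free start = Any.map⁺ (Any.map⁻ (classify closed G
  (free ∘ Any.map (λ {F} → ⊆ᵢ-trans {F} {⟦ code F ⟧} {G} (≅⇒⊇ᵢ {⟦ code F ⟧} {F} (code-correct F)))
        ∘ Any.map⁻)
  (Any.map⁺ (Any.map (λ {H} → below {H} {G}) start))))

-- A decidable stand-in for `𝒮`. It is weaker: `C 8` is sparse but not in `𝒮`. What matters is that
-- a graph that is not sparse lies outside `𝒮`.
Sparse : Graph → Set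
Sparse G = ¬ (G ⊇ᵢ-some obstructions)

free-++ : ∀ {Fs Gs G} → ¬ (G ⊇ᵢ-some Fs) → ¬ (G ⊇ᵢ-some Gs) → ¬ (G ⊇ᵢ-some (Fs ++ Gs))
free-++ {Fs} f g = [ f , g ]′ ∘ Any.++⁻ Fs

3P₁-free : ∀ {G} → Sparse G → ¬ (3 · P 1 ⊆ᵢ G) → G ⊆ᵢ P 4 ⊎ 2 · P 2 ⊆ᵢ G
3P₁-free {G} sparse free
  with find (Any.map⁻ {f = exact ∘ coded}
    (describes-exact (3 · P 1 ∷ obstructions) small small-closed {G}
      (free-++ {3 · P 1 ∷ []} {G = G} (free ∘ only) sparse) (here (empty-⊆ᵢ {K 0} G refl))))
... | H , H∈ , codeH≅G = Sum.map
  (⊆ᵢ-trans {G} {H} {P 4} (≅⇒⊇ᵢ {H} {G} H≅G))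
  (λ p → ⊆ᵢ-trans {2 · P 2} {H} {G} p (≅⇒⊆ᵢ {H} {G} H≅G))
  (All.lookup small-cases H∈)
  where
  H≅G = ≅-trans {H} {⟦ code H ⟧} {G} (≅-sym {⟦ code H ⟧} {H} (code-correct H)) codeH≅G

only-seed : ∀ {P : Seed → Set} {s} → Any P (s ∷ []) → P s
only-seed (here p) = p

-- The first two constructors describe `X` by seeds, to be combined with a description of `Y`. Each
-- of the last three settles the pair by itself.
data Shape (X Y : Graph) : Set where
  has-edge        : Any (_Describes X) edgedSeeds → Shape X Y
  no-edge         : ¬ (P 2 ⊆ᵢ X) → Any (_Describes X) edgelessSeeds → Shape X Y
  within-P₄       : Y ⊆ᵢ P 4 → Shape X Y
  partner-3P₁     : X ⊇ᵢ-some K₃-partners → 3 · P 1 ⊆ᵢ Y → Shape X Y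
  4P₁,K₁₃-2P₂     : X ⊇ᵢ-some (4 · P 1 ∷ K[ 1 , 3 ] ∷ []) → 2 · P 2 ⊆ᵢ Y → Shape X Y

edgeless-shape : ∀ {X} → ¬ (P 2 ⊆ᵢ X) → Any (_Describes X) edgelessSeeds
edgeless-shape {X} P₂⊈X with occurs? (5 · P 1) X
... | yes 5P₁⊆X = here (below {5 · P 1} {X} 5P₁⊆X)
... | no  5P₁⊈X = there (describes-exact (P 2 ∷ 5 · P 1 ∷ []) edgeless edgeless-closed {X}
  (free-++ {P 2 ∷ []} {5 · P 1 ∷ []} {X} (P₂⊈X ∘ only) (5P₁⊈X ∘ only)) (here (empty-⊆ᵢ {K 0} X refl)))

-- If `X` contains a partner and `Y` has no `3 · P 1`, then `Y` lies in `P 4` or contains `2 · P 2`.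
-- In the latter case (C) covers every `X` with `4 · P 1` or `K[ 1 , 3 ]`; all partners but
-- `3 · P 2` contain `4 · P 1`, which leaves only `X ≅ 3 · P 2`.
shape : ∀ {X Y} → Sparse X → Sparse Y → Shape X Y
shape {X} {Y} X-sparse Y-sparse with occurs? (P 2) X
... | no  P₂⊈X = no-edge P₂⊈X (edgeless-shape {X} P₂⊈X)
... | yes P₂⊆X with some-occurs? K₃-partners X
... | no  no-partner = has-edge (there (describes-exact (obstructions ++ K₃-partners) edged edged-closed {X}
  (free-++ {obstructions} {K₃-partners} {X} X-sparse no-partner) (here P₂⊆X)))
... | yes partner with occurs? (3 · P 1) Y
... | yes 3P₁⊆Y = partner-3P₁ partner 3P₁⊆Y
... | no  3P₁⊈Y with 3P₁-free {Y} Y-sparse 3P₁⊈Y | some-occurs? (4 · P 1 ∷ K[ 1 , 3 ] ∷ []) X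
... | inj₁ Y⊆P₄  | _        = within-P₄ Y⊆P₄
... | inj₂ 2P₂⊆Y | yes p    = 4P₁,K₁₃-2P₂ p 2P₂⊆Y
... | inj₂ 2P₂⊆Y | no  free with find partner
... | F , F∈ , F⊆X with All.lookup K₃-partners-cases F∈
... | inj₁ 3P₂⊆F = has-edge (here (only-seed (describes-exact
  (4 · P 1 ∷ K[ 1 , 3 ] ∷ obstructions) (3 · P 2 ∷ []) 3P₂-closed {X}
  (free-++ {4 · P 1 ∷ K[ 1 , 3 ] ∷ []} {obstructions} {X} free X-sparse)
  (here (⊆ᵢ-trans {3 · P 2} {F} {X} 3P₂⊆F F⊆X)))))
... | inj₂ 4P₁⊆F = contradiction (here (⊆ᵢ-trans {4 · P 1} {F} {X} 4P₁⊆F F⊆X)) free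

sparse-settled : ∀ {H₁ H₂} → Sparse H₁ → Sparse (co H₂) → Settled H₁ H₂
sparse-settled {H₁} {H₂} X-sparse Y-sparse =
  settle (shape {X} {Y} X-sparse Y-sparse) (shape {Y} {X} Y-sparse X-sparse)
  where
  X = H₁
  Y = co H₂

  by-rules : SomeApplies pairRules X Y → Settled H₁ H₂
  by-rules = pairRules-sound {H₁} {H₂}

  in-P₄ : H₁ ⊆ᵢ P 4 → Settled H₁ H₂
  in-P₄ p = by-A (H₁ , H₂ , ε , P₄-case (inj₁ p))

  co-in-P₄ : co H₂ ⊆ᵢ P 4 → Settled H₁ H₂
  co-in-P₄ p = by-A (co H₁ , co H₂ , complement ◅ ε , P₄-case (inj₂ p))

  settle : Shape X Y → Shape Y X → Settled H₁ H₂
  settle (within-P₄ p)         _                     = co-in-P₄ p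
  settle _                     (within-P₄ p)         = in-P₄ p
  settle (partner-3P₁ p q)     _                     =
    by-rules (resolve partners×3P₁ {X} {Y} (describes-above _ {X} p) (here (below {3 · P 1} {Y} q)))
  settle (4P₁,K₁₃-2P₂ p q)     _                     =
    by-rules (resolve 4P₁,K₁₃×2P₂ {X} {Y} (describes-above _ {X} p) (here (below {2 · P 2} {Y} q)))
  settle _                     (partner-3P₁ p q)     =
    by-rules (resolve 3P₁×partners {X} {Y} (here (below {3 · P 1} {X} q)) (describes-above _ {Y} p))
  settle _                     (4P₁,K₁₃-2P₂ p q)     =
    by-rules (resolve 2P₂×4P₁,K₁₃ {X} {Y} (here (below {2 · P 2} {X} q)) (describes-above _ {Y} p))
  settle (has-edge p)          (has-edge q)          = by-rules (resolve edged×edged {X} {Y} p q)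
  settle (has-edge p)          (no-edge _ q)         = by-rules (resolve edged×edgeless {X} {Y} p q)
  settle (no-edge _ p)         (has-edge q)          = by-rules (resolve edgeless×edged {X} {Y} p q)
  -- The Ramsey rule uses `avoids`, which is not `upward`, so seeds above `5 · P 1` cannot trigger
  -- it; the absence of edges is used directly.
  settle (no-edge P₂⊈X _)      (no-edge P₂⊈Y _)      =
    by-A (H₂ , H₁ , swap-∼ {H₁} {H₂} , bounded⇐ (there (there (here (2P₁⊈H₂ , P₂⊈X)))))
    where
    2P₁⊈H₂ : ¬ (2 · P 1 ⊆ᵢ H₂)
    2P₁⊈H₂ p = P₂⊈Y (⊆ᵢ-trans {P 2} {co (2 · P 1)} {co H₂} (toWitness {a? = P 2 ⊆ᵢ? co (2 · P 1)} _)
                      (co-mono {2 · P 1} {H₂} p))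

obstruct-𝒮 : ∀ {G} → G ⊇ᵢ-some obstructions → ¬ 𝒮 G
obstruct-𝒮 {G} p with find p
... | F , F∈ , F⊆G = obstruction⇒∉𝒮 {F} {G} (All.lookup obstructions-obstruct F∈) F⊆G

obstruct-co-𝒮 : ∀ {G} → co G ⊇ᵢ-some obstructions → ¬ co-𝒮 G
obstruct-co-𝒮 {G} p (H , H∈𝒮 , G≅coH) = obstruct-𝒮 {H} (Holds-≅ (contains obstructions) {co G} {H}
  (≅-trans {co G} {co (co H)} {H} (co-cong {G} {co H} G≅coH) (co-involutive H)) p) H∈𝒮

-- A `3 · P 1` in `G` would be a `K 3` in `co G`, and a `2 · P 2` would be a `C 4`; both are
-- obstructions.
bi-sparse : ∀ {G} → Sparse G → Sparse (co G) → G ⊆ᵢ P 4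
bi-sparse {G} sparse co-sparse with occurs? (3 · P 1) G
... | yes 3P₁⊆G = contradiction (here (⊆ᵢ-trans {K 3} {co (3 · P 1)} {co G}
  (toWitness {a? = K 3 ⊆ᵢ? co (3 · P 1)} _) (co-mono {3 · P 1} {G} 3P₁⊆G))) co-sparse
... | no  3P₁⊈G with 3P₁-free {G} sparse 3P₁⊈G
... | inj₁ G⊆P₄  = G⊆P₄
... | inj₂ 2P₂⊆G = contradiction (there (here (⊆ᵢ-trans {C 4} {co (2 · P 2)} {co G}
  (toWitness {a? = C 4 ⊆ᵢ? co (2 · P 2)} _) (co-mono {2 · P 2} {G} 2P₂⊆G)))) co-sparse

settled : ∀ H₁ H₂ → Settled H₁ H₂
settled H₁ H₂ with some-occurs? obstructions H₁ | some-occurs? obstructions (co H₂)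
                 | some-occurs? obstructions H₂ | some-occurs? obstructions (co H₁)
... | no p  | no q  | _     | _     = sparse-settled {H₁} {H₂} p q
... | _     | _     | no p  | no q  = Settled-sym {H₂} {H₁} (sparse-settled {H₂} {H₁} p q)
... | yes p | _     | yes q | _     = by-C
  (H₁ , H₂ , ε , 𝒮-case (obstruct-𝒮 {H₁} p) (obstruct-𝒮 {H₂} q))
... | _     | yes p | _     | yes q = by-C
  (H₁ , H₂ , ε , co-𝒮-case (obstruct-co-𝒮 {H₁} q) (obstruct-co-𝒮 {H₂} p))
... | no p  | _     | _     | no q  = by-A (H₁ , H₂ , ε , P₄-case (inj₁ (bi-sparse {H₁} p q)))
... | _     | no p  | no q  | _     = by-A (H₁ , H₂ , ε , P₄-case (inj₂ (bi-sparse {H₂} q p)))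

-- Pairs equivalent to a given pair

OneOf : List Graph → Graph → Set
OneOf Xs G = Any (G ≅_) Xs

OneOf-≅ : ∀ {Xs F G} → F ≅ G → OneOf Xs F → OneOf Xs G
OneOf-≅ {F = F} {G} F≅G = Any.map λ {X} → ≅-trans {G} {F} {X} (≅-sym {F} {G} F≅G)

oneOf? : ∀ Xs G → Dec (OneOf Xs G)
oneOf? Xs G = Any.any? (G ≅?_) Xs

Exchange : List Graph → Graph → Graph → Set
Exchange Xs F G = OneOf Xs F → OneOf Xs G

exchange? : ∀ Xs F G → Dec (Exchange Xs F G)
exchange? Xs F G = oneOf? Xs F →-dec oneOf? Xs G

-- Closure under operation (2), both as applied to the pair itself and as seen from its complement.
Saturated : List Graph → Set
Saturated Xs = Exchange Xs (3 · P 1) (P 1 ⊕ P 3)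
             × Exchange Xs (P 1 ⊕ P 3) (3 · P 1)
             × Exchange Xs (co (3 · P 1)) (co (P 1 ⊕ P 3))
             × Exchange Xs (co (P 1 ⊕ P 3)) (co (3 · P 1))

saturated? : ∀ Xs → Dec (Saturated Xs)
saturated? Xs = exchange? Xs (3 · P 1) (P 1 ⊕ P 3)
          ×-dec exchange? Xs (P 1 ⊕ P 3) (3 · P 1)
          ×-dec exchange? Xs (co (3 · P 1)) (co (P 1 ⊕ P 3))
          ×-dec exchange? Xs (co (P 1 ⊕ P 3)) (co (3 · P 1))

module _ (As Bs : List Graph) where

  Placed : Graph → Graph → Set
  Placed F₁ F₂ = (OneOf As F₁ × OneOf Bs F₂) ⊎ (OneOf Bs F₁ × OneOf As F₂)

  -- The invariant of `_⟶_`. Operation (2) changes one graph and leaves the other alone, so a list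
  -- for each suffices; complementing only exchanges the two summands.
  Reached : Pair → Set
  Reached (F₁ , F₂) = Placed F₁ F₂ ⊎ Placed (co F₁) (co F₂)

  Placed-map : ∀ {F₁ F₂ G₁ G₂} → (OneOf As F₁ → OneOf As G₁) → (OneOf Bs F₁ → OneOf Bs G₁) →
               (OneOf As F₂ → OneOf As G₂) → (OneOf Bs F₂ → OneOf Bs G₂) → Placed F₁ F₂ → Placed G₁ G₂
  Placed-map f₁ g₁ f₂ g₂ = Sum.map (Product.map f₁ g₂) (Product.map g₁ f₂)

  Placed-≅ : ∀ {F₁ F₂ G₁ G₂} → F₁ ≅ G₁ → F₂ ≅ G₂ → Placed F₁ F₂ → Placed G₁ G₂
  Placed-≅ {F₁} {F₂} {G₁} {G₂} p q = Placed-map {F₁} {F₂} {G₁} {G₂}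
    (OneOf-≅ {F = F₁} {G₁} p) (OneOf-≅ {F = F₁} {G₁} p)
    (OneOf-≅ {F = F₂} {G₂} q) (OneOf-≅ {F = F₂} {G₂} q)

  Placed-swap : ∀ {F₁ F₂} → Placed F₁ F₂ → Placed F₂ F₁
  Placed-swap (inj₁ (p , q)) = inj₂ (q , p)
  Placed-swap (inj₂ (p , q)) = inj₁ (q , p)

  module _ (As-saturated : Saturated As) (Bs-saturated : Saturated Bs) where

    step : ∀ {p q} → p ⟶ q → Reached p → Reached q
    step (same {F₁ , F₂} {G₁ , G₂} (inj₁ (p , q))) = Sum.map
      (Placed-≅ {F₁} {F₂} {G₁} {G₂} p q)
      (Placed-≅ {co F₁} {co F₂} {co G₁} {co G₂} (co-cong {F₁} {G₁} p) (co-cong {F₂} {G₂} q))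
    step (same {F₁ , F₂} {G₁ , G₂} (inj₂ (p , q))) = Sum.map
      (Placed-swap {G₂} {G₁} ∘ Placed-≅ {F₁} {F₂} {G₂} {G₁} p q)
      (Placed-swap {co G₂} {co G₁} ∘
       Placed-≅ {co F₁} {co F₂} {co G₂} {co G₁} (co-cong {F₁} {G₂} p) (co-cong {F₂} {G₁} q))
    step (complement {F₁} {F₂}) (inj₁ placed) = inj₂ (Placed-≅ {F₁} {F₂} {co (co F₁)} {co (co F₂)}
      (≅-sym {co (co F₁)} {F₁} (co-involutive F₁)) (≅-sym {co (co F₂)} {F₂} (co-involutive F₂)) placed)
    step complement (inj₂ placed) = inj₁ placed
    step (3P₁⇒P₁+P₃ {H}) = Sum.map
      (Placed-map {3 · P 1} {H} {P 1 ⊕ P 3} {H} (proj₁ As-saturated) (proj₁ Bs-saturated) id id)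
      (Placed-map {co (3 · P 1)} {co H} {co (P 1 ⊕ P 3)} {co H}
        (proj₁ (proj₂ (proj₂ As-saturated))) (proj₁ (proj₂ (proj₂ Bs-saturated))) id id)
    step (P₁+P₃⇒3P₁ {H}) = Sum.map
      (Placed-map {P 1 ⊕ P 3} {H} {3 · P 1} {H}
        (proj₁ (proj₂ As-saturated)) (proj₁ (proj₂ Bs-saturated)) id id)
      (Placed-map {co (P 1 ⊕ P 3)} {co H} {co (3 · P 1)} {co H}
        (proj₂ (proj₂ (proj₂ As-saturated))) (proj₂ (proj₂ (proj₂ Bs-saturated))) id id)

    reach : ∀ {p q} → p ∼ q → Reached p → Reached q
    reach ε         reached = reached
    reach (s ◅ p∼q) reached = reach p∼q (step s reached)

  -- The four negations match the four ways in which a pair can be `Reached`.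
  Inert : List Rule → Set
  Inert rs = All (λ A → All (λ B →
    ¬ SomeApplies rs A B × ¬ SomeApplies rs B A ×
    ¬ SomeApplies rs (co A) (co B) × ¬ SomeApplies rs (co B) (co A)) Bs) As

  inert? : ∀ rs → Dec (Inert rs)
  inert? rs = All.all? (λ A → All.all? (λ B →
    ¬? (applies? A B) ×-dec ¬? (applies? B A) ×-dec
    ¬? (applies? (co A) (co B)) ×-dec ¬? (applies? (co B) (co A))) Bs) As
    where
    check? : ∀ c G → Dec (Holds c G)
    check? c G = map′ (Holds-≅ c {⟦ code G ⟧} {G} (code-correct G))
                      (Holds-≅ c {G} {⟦ code G ⟧} (≅-sym {⟦ code G ⟧} {G} (code-correct G)))
                      (holds? c (code G))
    applies? : ∀ F₁ F₂ → Dec (SomeApplies rs F₁ F₂)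
    applies? F₁ F₂ = Any.any? (λ (c , d) → check? c F₁ ×-dec check? d F₂) rs

  SomeApplies-≅ : ∀ rs {F₁ F₂ G₁ G₂} → F₁ ≅ G₁ → F₂ ≅ G₂ → SomeApplies rs F₁ F₂ → SomeApplies rs G₁ G₂
  SomeApplies-≅ rs {F₁} {F₂} {G₁} {G₂} p q = Any.map λ {(c , d)} →
    Product.map (Holds-≅ c {F₁} {G₁} p) (Holds-≅ d {F₂} {G₂} q)

  ≅-co : ∀ {F G} → co F ≅ G → F ≅ co G
  ≅-co {F} {G} p = ≅-trans {F} {co (co F)} {co G}
    (≅-sym {co (co F)} {F} (co-involutive F)) (co-cong {co F} {G} p)

  inert : ∀ {rs} → Inert rs → ∀ {F₁ F₂} → Reached (F₁ , F₂) → ¬ SomeApplies rs F₁ F₂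
  inert {rs} none {F₁} {F₂} reached applies with reached
  ... | inj₁ (inj₁ (a , b)) with find a | find b
  ... | A , A∈ , p | B , B∈ , q =
    proj₁ (All.lookup (All.lookup none A∈) B∈) (SomeApplies-≅ rs {F₁} {F₂} {A} {B} p q applies)
  inert {rs} none {F₁} {F₂} reached applies | inj₁ (inj₂ (b , a)) with find a | find b
  ... | A , A∈ , p | B , B∈ , q =
    proj₁ (proj₂ (All.lookup (All.lookup none A∈) B∈)) (SomeApplies-≅ rs {F₁} {F₂} {B} {A} q p applies)
  inert {rs} none {F₁} {F₂} reached applies | inj₂ (inj₁ (a , b)) with find a | find b
  ... | A , A∈ , p | B , B∈ , q =
    proj₁ (proj₂ (proj₂ (All.lookup (All.lookup none A∈) B∈)))
      (SomeApplies-≅ rs {F₁} {F₂} {co A} {co B} (≅-co {F₁} {A} p) (≅-co {F₂} {B} q) applies)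
  inert {rs} none {F₁} {F₂} reached applies | inj₂ (inj₂ (b , a)) with find a | find b
  ... | A , A∈ , p | B , B∈ , q =
    proj₂ (proj₂ (proj₂ (All.lookup (All.lookup none A∈) B∈)))
      (SomeApplies-≅ rs {F₁} {F₂} {co B} {co A} (≅-co {F₁} {B} q) (≅-co {F₂} {A} p) applies)

-- Members of `𝒮` and `co-𝒮`

𝒮-samples : List Graph
𝒮-samples = 3 · P 1 ∷ 2 · P 1 ⊕ P 2 ∷ 2 · P 2 ∷ P 1 ⊕ P 3
  ∷ P 1 ⊕ 2 · P 2 ∷ P 2 ⊕ P 3 ∷ P 1 ⊕ P 4 ∷ P 5
  ∷ 3 · P 2 ∷ P 1 ⊕ P 2 ⊕ P 3 ∷ P 2 ⊕ P 4 ∷ P 1 ⊕ P 5 ∷ P 6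
  ∷ P 1 ⊕ S[ 1 , 1 , 3 ] ∷ S[ 1 , 2 , 3 ] ∷ []

1≤ : ∀ {n} → 1 ≤ suc n
1≤ = s≤s z≤n

samples∈𝒮 : All 𝒮 𝒮-samples
samples∈𝒮 =
    𝒮-· {P 1} 3 P₁
  ∷ 𝒮-⊕ {2 · P 1} {P 2} (𝒮-· {P 1} 2 P₁) P₂
  ∷ 𝒮-· {P 2} 2 P₂
  ∷ 𝒮-⊕ {P 1} {P 3} P₁ P₃
  ∷ 𝒮-⊕ {P 1} {2 · P 2} P₁ (𝒮-· {P 2} 2 P₂)
  ∷ 𝒮-⊕ {P 2} {P 3} P₂ P₃
  ∷ 𝒮-⊕ {P 1} {P 4} P₁ P₄
  ∷ P₅
  ∷ 𝒮-· {P 2} 3 P₂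
  ∷ 𝒮-⊕ {P 1} {P 2 ⊕ P 3} P₁ (𝒮-⊕ {P 2} {P 3} P₂ P₃)
  ∷ 𝒮-⊕ {P 2} {P 4} P₂ P₄
  ∷ 𝒮-⊕ {P 1} {P 5} P₁ P₅
  ∷ path∈𝒮 6 1≤
  ∷ 𝒮-⊕ {P 1} {S[ 1 , 1 , 3 ]} P₁ (claw∈𝒮 1 1 3 1≤ 1≤ 1≤)
  ∷ claw∈𝒮 1 2 3 1≤ 1≤ (s≤s 1≤)
  ∷ []
  where
  P₁ = path∈𝒮 1 1≤
  P₂ = path∈𝒮 2 1≤
  P₃ = path∈𝒮 3 1≤
  P₄ = path∈𝒮 4 1≤
  P₅ = path∈𝒮 5 1≤

-- Isomorphism with a sample is decidable, whereas `𝒮` itself asks for components. This makes the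
-- certificate a matter of evaluation.
In𝒮 Inco-𝒮 : List Graph → Set
In𝒮    = All (OneOf 𝒮-samples)
Inco-𝒮 = All (OneOf 𝒮-samples ∘ co)

known : ∀ {G} → OneOf 𝒮-samples G → 𝒮 G
known {G} p with find p
... | H , H∈ , G≅H = 𝒮-≅ {H} {G} (≅-sym {G} {H} G≅H) (All.lookup samples∈𝒮 H∈)

In𝒮⇒𝒮 : ∀ {Xs G} → In𝒮 Xs → OneOf Xs G → 𝒮 G
In𝒮⇒𝒮 {G = G} all p with find p
... | X , X∈ , G≅X = 𝒮-≅ {X} {G} (≅-sym {G} {X} G≅X) (known {X} (All.lookup all X∈))

In𝒮⇒co-𝒮 : ∀ {Xs G} → In𝒮 Xs → OneOf Xs (co G) → co-𝒮 G
In𝒮⇒co-𝒮 {G = G} all p = co G , In𝒮⇒𝒮 {G = co G} all p , ≅-sym {co (co G)} {G} (co-involutive G)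

Inco-𝒮⇒co-𝒮 : ∀ {Xs G} → Inco-𝒮 Xs → OneOf Xs G → co-𝒮 G
Inco-𝒮⇒co-𝒮 {G = G} all p with find p
... | X , X∈ , G≅X = co X , known {co X} (All.lookup all X∈)
                   , ≅-trans {G} {X} {co (co X)} G≅X (≅-sym {co (co X)} {X} (co-involutive X))

Inco-𝒮⇒𝒮 : ∀ {Xs G} → Inco-𝒮 Xs → OneOf Xs (co G) → 𝒮 G
Inco-𝒮⇒𝒮 {G = G} all p with find p
... | X , X∈ , coG≅X = 𝒮-≅ {co X} {G}
  (≅-trans {co X} {co (co G)} {G} (co-cong {X} {co G} (≅-sym {co G} {X} coG≅X)) (co-involutive G))
  (known {co X} (All.lookup all X∈))

Split : List Graph → List Graph → Set
Split As Bs = (In𝒮 As × Inco-𝒮 Bs) ⊎ (Inco-𝒮 As × In𝒮 Bs)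

split? : ∀ As Bs → Dec (Split As Bs)
split? As Bs = (in𝒮? As ×-dec inco-𝒮? Bs) ⊎-dec (inco-𝒮? As ×-dec in𝒮? Bs)
  where
  in𝒮?    = All.all? (oneOf? 𝒮-samples)
  inco-𝒮? = All.all? (oneOf? 𝒮-samples ∘ co)

-- Swapping or complementing the pair exchanges the two alternatives of the conclusion. Either one
-- contradicts both the `𝒮-case` and the `co-𝒮-case` of (C).
split-classes : ∀ {As Bs} → Split As Bs → ∀ {F₁ F₂} → Reached As Bs (F₁ , F₂) →
                (𝒮 F₁ × co-𝒮 F₂) ⊎ (co-𝒮 F₁ × 𝒮 F₂)
split-classes (inj₁ (a , b)) {F₁} {F₂} (inj₁ (inj₁ (p , q))) =
  inj₁ (In𝒮⇒𝒮 {G = F₁} a p , Inco-𝒮⇒co-𝒮 {G = F₂} b q)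
split-classes (inj₁ (a , b)) {F₁} {F₂} (inj₁ (inj₂ (p , q))) =
  inj₂ (Inco-𝒮⇒co-𝒮 {G = F₁} b p , In𝒮⇒𝒮 {G = F₂} a q)
split-classes (inj₁ (a , b)) {F₁} {F₂} (inj₂ (inj₁ (p , q))) =
  inj₂ (In𝒮⇒co-𝒮 {G = F₁} a p , Inco-𝒮⇒𝒮 {G = F₂} b q)
split-classes (inj₁ (a , b)) {F₁} {F₂} (inj₂ (inj₂ (p , q))) =
  inj₁ (Inco-𝒮⇒𝒮 {G = F₁} b p , In𝒮⇒co-𝒮 {G = F₂} a q)
split-classes (inj₂ (a , b)) {F₁} {F₂} (inj₁ (inj₁ (p , q))) =
  inj₂ (Inco-𝒮⇒co-𝒮 {G = F₁} a p , In𝒮⇒𝒮 {G = F₂} b q)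
split-classes (inj₂ (a , b)) {F₁} {F₂} (inj₁ (inj₂ (p , q))) =
  inj₁ (In𝒮⇒𝒮 {G = F₁} b p , Inco-𝒮⇒co-𝒮 {G = F₂} a q)
split-classes (inj₂ (a , b)) {F₁} {F₂} (inj₂ (inj₁ (p , q))) =
  inj₁ (Inco-𝒮⇒𝒮 {G = F₁} a p , In𝒮⇒co-𝒮 {G = F₂} b q)
split-classes (inj₂ (a , b)) {F₁} {F₂} (inj₂ (inj₂ (p , q))) =
  inj₂ (In𝒮⇒co-𝒮 {G = F₁} b p , Inco-𝒮⇒𝒮 {G = F₂} a q)

-- 3P₁ and K₃ are the only graphs in openPairs that 3P₁⇒P₁+P₃ affects, directly or after complementation.
alternatives : Graph → List Graph
alternatives G = G ∷ (if does (G ≅? 3 · P 1) then P 1 ⊕ P 3 ∷ [] else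
                      if does (G ≅? K 3) then co (P 1 ⊕ P 3) ∷ [] else [])

-- The graphs `X` and `Y` are not (`X`, `Y`)-free, so whichever of them is (`A`, `B`)-free refutes
-- the inclusion in (B).
NoSubclass : Graph → Graph → Pair → Set
NoSubclass A B (X , Y) = (¬ (A ⊆ᵢ X) × ¬ (B ⊆ᵢ X)) ⊎ (¬ (A ⊆ᵢ Y) × ¬ (B ⊆ᵢ Y))

-- Neither `A` nor `B` is (`A`, `B`)-free. One that contains no graph of `Xs ++ Ys` is (`F₁`,
-- `F₂`)-free for all `F₁`, `F₂` allowed by the case at once, which refutes the inclusion in (D).
NoSuperclass : Graph → Graph → List Graph × List Graph → Set
NoSuperclass A B (Xs , Ys) = ¬ (A ⊇ᵢ-some (Xs ++ Ys)) ⊎ ¬ (B ⊇ᵢ-some (Xs ++ Ys))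

boundedAtomPairs : List Pair
boundedAtomPairs = (P 6 , co (2 · P 2)) ∷ (2 · P 2 , co (P 2 ⊕ P 3)) ∷ []

Undecided : Pair → Set
Undecided (A , B) =
    (Saturated (alternatives A) × Saturated (alternatives B))
  × Inert (alternatives A) (alternatives B) (boundedRules ++ unboundedRules)
  × Split (alternatives A) (alternatives B)
  × All (NoSubclass A B) boundedAtomPairs
  × All (NoSuperclass A B) atomUnboundedRules

undecided? : ∀ p → Dec (Undecided p)
undecided? (A , B) =
        (saturated? (alternatives A) ×-dec saturated? (alternatives B))
  ×-dec inert? (alternatives A) (alternatives B) (boundedRules ++ unboundedRules)
  ×-dec split? (alternatives A) (alternatives B)
  ×-dec All.all? (λ (X , Y) → (¬? (A ⊆ᵢ? X) ×-dec ¬? (B ⊆ᵢ? X)) ⊎-dec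
                              (¬? (A ⊆ᵢ? Y) ×-dec ¬? (B ⊆ᵢ? Y))) boundedAtomPairs
  ×-dec All.all? (λ (Xs , Ys) → ¬? (Any.any? (_⊆ᵢ? A) (Xs ++ Ys)) ⊎-dec
                                ¬? (Any.any? (_⊆ᵢ? B) (Xs ++ Ys))) atomUnboundedRules

abstract
  openPairs-undecided : All Undecided openPairs
  openPairs-undecided = toWitness {a? = All.all? undecided? openPairs} _

-- Refuting the four conditions for the pairs in (E)

free-≋ : ∀ {H₁ H₂ A B} → (H₁ , H₂) ≋ (A , B) → ∀ X → ¬ (A ⊆ᵢ X) × ¬ (B ⊆ᵢ X) → Free H₁ H₂ X
free-≋ {H₁} {H₂} {A} {B} (inj₁ (p , q)) X (A⊈X , B⊈X) =
  A⊈X ∘ ⊆ᵢ-trans {A} {H₁} {X} (≅⇒⊇ᵢ {H₁} {A} p) , B⊈X ∘ ⊆ᵢ-trans {B} {H₂} {X} (≅⇒⊇ᵢ {H₂} {B} q)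
free-≋ {H₁} {H₂} {A} {B} (inj₂ (p , q)) X (A⊈X , B⊈X) =
  B⊈X ∘ ⊆ᵢ-trans {B} {H₁} {X} (≅⇒⊇ᵢ {H₁} {B} p) , A⊈X ∘ ⊆ᵢ-trans {A} {H₂} {X} (≅⇒⊇ᵢ {H₂} {A} q)

not-free-≋ : ∀ {H₁ H₂ A B} → (H₁ , H₂) ≋ (A , B) → ¬ Free H₁ H₂ A × ¬ Free H₁ H₂ B
not-free-≋ {H₁} {H₂} {A} {B} (inj₁ (p , q)) =
  (λ (f , _) → f (≅⇒⊆ᵢ {H₁} {A} p)) , (λ (_ , f) → f (≅⇒⊆ᵢ {H₂} {B} q))
not-free-≋ {H₁} {H₂} {A} {B} (inj₂ (p , q)) =
  (λ (_ , f) → f (≅⇒⊆ᵢ {H₂} {A} q)) , (λ (f , _) → f (≅⇒⊆ᵢ {H₁} {B} p))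

module _ {H₁ H₂ A B : Graph} (H≋ : (H₁ , H₂) ≋ (A , B)) (undecided : Undecided (A , B)) where

  As = alternatives A
  Bs = alternatives B

  reached : ∀ {F₁ F₂} → (H₁ , H₂) ∼ (F₁ , F₂) → Reached As Bs (F₁ , F₂)
  reached p∼ = let (As-saturated , Bs-saturated) , _ = undecided in
    reach As Bs As-saturated Bs-saturated p∼
      (inj₁ (Sum.map (λ (p , q) → here p , here q) (λ (p , q) → here p , here q) H≋))

  classes : ∀ {F₁ F₂} → (H₁ , H₂) ∼ (F₁ , F₂) → (𝒮 F₁ × co-𝒮 F₂) ⊎ (co-𝒮 F₁ × 𝒮 F₂)
  classes {F₁} {F₂} p∼ =
    split-classes (proj₁ (proj₂ (proj₂ undecided))) {F₁} {F₂} (reached {F₁} {F₂} p∼)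

  ¬A : ¬ ConditionA H₁ H₂
  ¬A (F₁ , F₂ , p∼ , case) = inert As Bs (proj₁ (proj₂ undecided)) {F₁} {F₂}
    (reached {F₁} {F₂} p∼) (Any.++⁺ˡ (bounded⇒ case))

  ¬C : ¬ ConditionC H₁ H₂
  ¬C (F₁ , F₂ , p∼ , case) with unbounded⇒ case
  ... | inj₂ (inj₂ applies) = inert As Bs (proj₁ (proj₂ undecided)) {F₁} {F₂}
    (reached {F₁} {F₂} p∼) (Any.++⁺ʳ boundedRules applies)
  ... | inj₁ (F₁∉𝒮 , F₂∉𝒮) =
    [ F₁∉𝒮 ∘ proj₁ , F₂∉𝒮 ∘ proj₂ ]′ (classes {F₁} {F₂} p∼)
  ... | inj₂ (inj₁ (F₁∉co-𝒮 , F₂∉co-𝒮)) =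
    [ F₂∉co-𝒮 ∘ proj₂ , F₁∉co-𝒮 ∘ proj₁ ]′ (classes {F₁} {F₂} p∼)

  no-subclass : ∀ {X Y} → NoSubclass A B (X , Y) → ¬ (∀ {G} → Free H₁ H₂ G → Free X Y G)
  no-subclass {X} {Y} (inj₁ A,B⊈X) sub =
    proj₁ (sub {X} (free-≋ {H₁} {H₂} {A} {B} H≋ X A,B⊈X)) (⊆ᵢ-refl {X})
  no-subclass {X} {Y} (inj₂ A,B⊈Y) sub =
    proj₂ (sub {Y} (free-≋ {H₁} {H₂} {A} {B} H≋ Y A,B⊈Y)) (⊆ᵢ-refl {Y})

  ¬B : ¬ ConditionB H₁ H₂
  ¬B = [ no-subclass {P 6} {co (2 · P 2)} (All.lookup none (here refl))
       , no-subclass {2 · P 2} {co (P 2 ⊕ P 3)} (All.lookup none (there (here refl))) ]′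
    where none = proj₁ (proj₂ (proj₂ (proj₂ undecided)))

  ¬D : ¬ ConditionD H₁ H₂
  ¬D (F₁ , F₂ , sub , case) with find (atomUnbounded⇒ case)
  ... | (Xs , Ys) , r∈ , F₁⊇ , F₂⊇ =
    [ proj₁ (not-free-≋ {H₁} {H₂} {A} {B} H≋) ∘ sub {A} ∘ F-free A
    , proj₂ (not-free-≋ {H₁} {H₂} {A} {B} H≋) ∘ sub {B} ∘ F-free B ]′
      (All.lookup (proj₂ (proj₂ (proj₂ (proj₂ undecided)))) r∈)
    where
    F-free : ∀ G → ¬ (G ⊇ᵢ-some (Xs ++ Ys)) → Free F₁ F₂ G
    F-free G none = (λ F₁⊆G → none (Any.++⁺ˡ (Any.map (λ {X} p → ⊆ᵢ-trans {X} {F₁} {G} p F₁⊆G) F₁⊇)))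
                  , (λ F₂⊆G → none (Any.++⁺ʳ Xs (Any.map (λ {Y} p → ⊆ᵢ-trans {Y} {F₂} {G} p F₂⊆G) F₂⊇)))

not-exceptional : ∀ {H₁ H₂} → ¬ (H₁ ≅ paw) → ¬ (H₁ ≅ P 1 ⊕ P 3) →
                  ¬ (H₁ ≅ 3 · P 1 × H₂ ≅ co S[ 1 , 2 , 3 ]) → ¬ SomeApplies exceptionRules H₁ H₂
not-exceptional paw P₁+P₃ pair (here (p , _))         = paw p
not-exceptional paw P₁+P₃ pair (there (here (p , _))) = P₁+P₃ p
not-exceptional paw P₁+P₃ pair (there (there (here p))) = pair p

theorem31 :
  (H₁ H₂ : Graph) →
  ¬ (H₁ ≅ co (P 1 ⊕ P 3)) → ¬ (H₁ ≅ P 1 ⊕ P 3) →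
  ¬ (H₂ ≅ co (P 1 ⊕ P 3)) → ¬ (H₂ ≅ P 1 ⊕ P 3) →
  ¬ ((H₁ , H₂) ≋ (3 · P 1 , co S[ 1 , 2 , 3 ])) →
  (¬ ConditionA H₁ H₂ × ¬ ConditionB H₁ H₂ × ¬ ConditionC H₁ H₂ × ¬ ConditionD H₁ H₂)
    ⇔ Any ((H₁ , H₂) ≋_) openPairs
theorem31 H₁ H₂ H₁≇paw H₁≇P₁+P₃ H₂≇paw H₂≇P₁+P₃ H≇pair = mk⇔ to from
  where
  to : ¬ ConditionA H₁ H₂ × ¬ ConditionB H₁ H₂ × ¬ ConditionC H₁ H₂ × ¬ ConditionD H₁ H₂ →
       Any ((H₁ , H₂) ≋_) openPairs
  to (¬A , ¬B , ¬C , ¬D) with settled H₁ H₂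
  ... | by-A A = contradiction A ¬A
  ... | by-B B = contradiction B ¬B
  ... | by-C C = contradiction C ¬C
  ... | by-D D = contradiction D ¬D
  ... | exceptional (inj₁ e) =
    ⊥-elim (not-exceptional {H₁} {H₂} H₁≇paw H₁≇P₁+P₃ (H≇pair ∘ inj₁) e)
  ... | exceptional (inj₂ e) =
    ⊥-elim (not-exceptional {H₂} {H₁} H₂≇paw H₂≇P₁+P₃ (λ (p , q) → H≇pair (inj₂ (q , p))) e)
  ... | open-pair (inj₁ e) = Any.map inj₁ (Any.map⁻ {f = λ (A , B) → is A , is B} e)
  ... | open-pair (inj₂ e) = Any.map (λ (p , q) → inj₂ (q , p)) (Any.map⁻ {f = λ (A , B) → is A , is B} e)

  from : Any ((H₁ , H₂) ≋_) openPairs →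
         ¬ ConditionA H₁ H₂ × ¬ ConditionB H₁ H₂ × ¬ ConditionC H₁ H₂ × ¬ ConditionD H₁ H₂
  from p with find p
  ... | (A , B) , AB∈ , H≋ = ¬A {H₁} {H₂} {A} {B} H≋ u , ¬B {H₁} {H₂} {A} {B} H≋ u
                     , ¬C {H₁} {H₂} {A} {B} H≋ u , ¬D {H₁} {H₂} {A} {B} H≋ u
    where u = All.lookup openPairs-undecided AB∈
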